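{- For all integers $a,b\geq 0$, \[ h^\ast_{a,b}(t) \;=\; \sum_{i=0}^{\min(a,b)}\binom{2i}{i}\binom{a}{i}\binom{b}{i}\,t^i(1+t)^{a+b+1-2i}. \] In particular, $h^\ast_{a,b}(t)$ is $\gamma$-positive.
   Context: For a finite simple graph $G=(V,E)$ the symmetric edge polytope is $P_G=\mathrm{conv}(e_v-e_w,\,e_w-e_v : vw\in E)\subset\mathbb{R}^V$, where $e_v$ are the standard unit vectors. Let $K_{a+1,b+1}$ be the complete bipartite graph with parts of sizes $a+1$ and $b+1$. The polytope $P=P_{K_{a+1,b+1}}$ has dimension $d=a+b+1$, and its $h^\ast$-polynomial $h^\ast_{a,b}(t)$ is defined by $\sum_{n\geq 0}|nP\cap\mathbb{Z}^V|\,t^n = h^\ast_{a,b}(t)/(1-t)^{d+1}$. A polynomial $f$ of degree $d$ is $\gamma$-positive if $f(t)=\sum_{i\ge 0}\gamma_i t^i(1+t)^{d-2i}$ for some $\gamma_i\geq 0$.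
   Formalization: Membership of a lattice point in nP is expressed by convex combinations of the vertices with rational rather than real coefficients; for lattice points this gives the same set, since a rational linear system is solvable over the reals iff over the rationals. -}

module Defs where

open import Data.Nat as ℕ using (ℕ; zero; suc; _∸_; _≤?_; _⊓_)
open import Data.Nat.Combinatorics using (_C_)
open import Data.Integer using (ℤ; +_)
open import Data.Rational as ℚ using (ℚ; 0ℚ; 1ℚ; _/_)
open import Data.Fin using (Fin; _↑ˡ_; _↑ʳ_)
open import Data.Fin.Properties using () renaming (_≟_ to _≟ᶠ_)
open import Data.Bool using (Bool; true; false)
open import Data.Vec using (Vec; lookup)
open import Data.List using (List; length)
open import Data.List.Membership.Propositional using (_∈_)
open import Data.List.Relation.Unary.Unique.Propositional using (Unique)
open import Data.Product using (Σ; _×_)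
open import Function.Bundles using (_⇔_)
open import Relation.Nullary using (yes; no)
open import Relation.Binary.PropositionalEquality using (_≡_)

sumℕ≤ : ℕ → (ℕ → ℕ) → ℕ
sumℕ≤ zero    f = f 0
sumℕ≤ (suc n) f = sumℕ≤ n f ℕ.+ f (suc n)

sumFinℚ : (n : ℕ) → (Fin n → ℚ) → ℚ
sumFinℚ zero    f = 0ℚ
sumFinℚ (suc n) f = f Fin.zero ℚ.+ sumFinℚ n (λ i → f (Fin.suc i))

-- Vertex set V = Fin ((a+1)+(b+1)); the first a+1 vertices form one part,
-- the last b+1 the other.  Edges are {i, j} with i in the first part and
-- j in the second.
nVert : ℕ → ℕ → ℕ
nVert a b = suc a ℕ.+ suc b

leftV : (a b : ℕ) → Fin (suc a) → Fin (nVert a b)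
leftV a b i = i ↑ˡ suc b

rightV : (a b : ℕ) → Fin (suc b) → Fin (nVert a b)
rightV a b j = suc a ↑ʳ j

δ : ∀ {m} → Fin m → Fin m → ℚ
δ u v with u ≟ᶠ v
... | yes _ = 1ℚ
... | no  _ = 0ℚ

-- Coordinate u of the generator  s·(e_{left i} − e_{right j}),
-- with s = +1 for true and s = −1 for false.  These are the points
-- e_v − e_w and e_w − e_v for the edges vw of K_{a+1,b+1}.
generator : (a b : ℕ) → Fin (suc a) → Fin (suc b) → Bool → Fin (nVert a b) → ℚ
generator a b i j true  u = δ u (leftV a b i) ℚ.- δ u (rightV a b j)
generator a b i j false u = δ u (rightV a b j) ℚ.- δ u (leftV a b i)

ℤtoℚ : ℤ → ℚ
ℤtoℚ z = z / 1

ℕtoℚ : ℕ → ℚ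
ℕtoℚ n = (+ n) / 1

sumGen : (a b : ℕ) → (Fin (suc a) → Fin (suc b) → Bool → ℚ) → ℚ
sumGen a b w = sumFinℚ (suc a) (λ i → sumFinℚ (suc b) (λ j → w i j true ℚ.+ w i j false))

-- x ∈ n·P_{K_{a+1,b+1}}:  x is a convex combination of the generators,
-- scaled by n, i.e. x = Σ λ_g g with λ_g ≥ 0 and Σ λ_g = n
-- (coefficients taken rational).
InDilate : (a b n : ℕ) → Vec ℤ (nVert a b) → Set
InDilate a b n x =
  Σ (Fin (suc a) → Fin (suc b) → Bool → ℚ) λ c →
    (∀ i j s → 0ℚ ℚ.≤ c i j s)
  × (sumGen a b c ≡ ℕtoℚ n)
  × (∀ u → ℤtoℚ (lookup x u) ≡ sumGen a b (λ i j s → c i j s ℚ.* generator a b i j s u))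

LatticeCount : (a b n N : ℕ) → Set
LatticeCount a b n N =
  Σ (List (Vec ℤ (nVert a b))) λ L →
    Unique L × (∀ x → (x ∈ L) ⇔ InDilate a b n x) × (length L ≡ N)

-- Polynomials are given by their coefficient sequences ℕ → ℕ. -------

-- coefficient of t^k in t^i (1+t)^e
coeffMono : (i e k : ℕ) → ℕ
coeffMono i e k with i ≤? k
... | yes _ = e C (k ∸ i)
... | no  _ = 0

dim : ℕ → ℕ → ℕ
dim a b = a ℕ.+ b ℕ.+ 1

rhsCoeff : (a b k : ℕ) → ℕ
rhsCoeff a b k =
  sumℕ≤ (a ⊓ b) (λ i →
    ((2 ℕ.* i) C i) ℕ.* (a C i) ℕ.* (b C i) ℕ.* coeffMono i (dim a b ∸ 2 ℕ.* i) k)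

-- Ehrhart series identity  Σ_n L(n) t^n = h(t)/(1-t)^{d+1}, coefficientwise:
-- L(n) = Σ_{k=0}^{n} h_k C(n-k+d, d).
ehrhartFromH : (d : ℕ) → (ℕ → ℕ) → ℕ → ℕ
ehrhartFromH d h n = sumℕ≤ n (λ k → h k ℕ.* ((n ∸ k ℕ.+ d) C d))

GammaPositive : (d : ℕ) → (ℕ → ℕ) → Set
GammaPositive d f =
  Σ (ℕ → ℕ) λ γ → ∀ k → f k ≡ sumℕ≤ (d ℕ./ 2) (λ i → γ i ℕ.* coeffMono i (d ∸ 2 ℕ.* i) k)

{-# OPTIONS --safe #-}
module Submission where

-- A lattice point (p, q) lies in nP exactly when Σp + Σq = 0, ‖p‖₁ ≤ n and ‖q‖₁ ≤ n. Let F_a(U,V) be the number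
-- of p ∈ ℤ^{a+1} such that U minus the sum of the positive entries and V minus the sum of the absolute values of
-- the negative entries are the same natural number. Then nP has S(n) + S(n-1) lattice points, where
-- S(n) = Σ_{U+V=n} F_a(U,V) F_b(V,U). Generating functions give
--   F_a(U,V) = Σ_{j+j′=a} (a choose j) (U+j choose j) (V choose j′),
-- and Vandermonde convolution in U + V = n turns Σ S(n) tⁿ into (1-t)^{-(a+b+2)} times
--   Σ_{j+j′=a, k+k′=b} (a choose j) (b choose k) (j+k′ choose j) (k+j′ choose k) t^{j′+k′}.
-- Expanding (j+k′ choose j) = Σ_i (j choose i)(k′ choose i), (k+j′ choose k) = Σ_r (k choose r)(j′ choose r) and
-- summing over j and k first leaves
--   Σ_{i,r} (a choose m)(b choose m)(m choose i)(m choose r) t^m (1+t)^{a+b-2m},  m = i + r,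
-- whose inner sum over i + r = m is (2m choose m). The missing factor 1 + t comes from S(n) + S(n-1).

open import Defs
open import Data.Nat using (ℕ)
open import Data.Product using (_×_; _,_)
open import Function.Bundles using (mk⇔; Equivalence)
open import Relation.Binary.PropositionalEquality

-- Given a representation of a point of nP, let A be the total weight on the generators
-- `e_left - e_right` and B the total weight on their negatives. Then A + B = n and A - B = Σp, so
-- the point alone determines A and B. Row sums of the weights write the entries of p as differences
-- of nonnegative numbers with totals A and B; column sums do the same for q with totals B and A.
-- Hence the exchanged arguments in the second factor of S(n). Conversely, all such margins are
-- realised: in a complete bipartite graph each orientation is a transportation problem without
-- forbidden cells. This is why two norm bounds and one linear equation describe nP. Since 2A = n +
-- Σp, the numbers A and B are both integers or both half-integers. U and V are their integer parts,
-- with U + V = n in the first case and U + V = n - 1 in the second. In the second case one unit of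
-- weight is left over; it is spent on the origin, the midpoint of two opposite generators.

module BinomialSums where

  open import Data.Nat
  -- With the library's fixity, _C_ would bind weaker than _*_.
  open import Data.Nat.Combinatorics renaming (_C_ to infixl 8 _C_)
  open import Data.Nat.DivMod using (m/n*n≡m; m*n/n≡m; /-monoˡ-≤)
  open import Data.Nat.Properties
  open import Data.Nat.Tactic.RingSolver using (solve-∀)
  open import Data.Product using (uncurry)
  open import Relation.Nullary using (yes; no; contradiction)
  open import Algebra.Properties.CommutativeSemigroup +-commutativeSemigroup using (interchange)
  open ≡-Reasoning

  -- Finite sums over ranges and antidiagonals

  sum-cong : ∀ n {f g : ℕ → ℕ} → (∀ i → i ≤ n → f i ≡ g i) → sumℕ≤ n f ≡ sumℕ≤ n g
  sum-cong zero    e = e 0 z≤n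
  sum-cong (suc n) e = cong₂ _+_ (sum-cong n (λ i i≤n → e i (m≤n⇒m≤1+n i≤n))) (e (suc n) ≤-refl)

  sum-+ : ∀ n (f g : ℕ → ℕ) → sumℕ≤ n f + sumℕ≤ n g ≡ sumℕ≤ n (λ i → f i + g i)
  sum-+ zero    f g = refl
  sum-+ (suc n) f g = trans (interchange (sumℕ≤ n f) (f (suc n)) (sumℕ≤ n g) (g (suc n))) (cong (_+ (f (suc n) + g (suc n))) (sum-+ n f g))

  sum-*ˡ : ∀ n c (f : ℕ → ℕ) → c * sumℕ≤ n f ≡ sumℕ≤ n (λ i → c * f i)
  sum-*ˡ zero    c f = refl
  sum-*ˡ (suc n) c f = trans (*-distribˡ-+ c (sumℕ≤ n f) (f (suc n))) (cong (_+ c * f (suc n)) (sum-*ˡ n c f))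

  sum-*ʳ : ∀ n c (f : ℕ → ℕ) → sumℕ≤ n f * c ≡ sumℕ≤ n (λ i → f i * c)
  sum-*ʳ zero    c f = refl
  sum-*ʳ (suc n) c f = trans (*-distribʳ-+ c (sumℕ≤ n f) (f (suc n))) (cong (_+ f (suc n) * c) (sum-*ʳ n c f))

  sum-suc : ∀ n (f : ℕ → ℕ) → sumℕ≤ (suc n) f ≡ f 0 + sumℕ≤ n (λ i → f (suc i))
  sum-suc zero    f = refl
  sum-suc (suc n) f = trans (cong (_+ f (suc (suc n))) (sum-suc n f)) (+-assoc (f 0) (sumℕ≤ n (λ i → f (suc i))) (f (suc (suc n))))

  sum-zero : ∀ n {f : ℕ → ℕ} → (∀ i → f i ≡ 0) → sumℕ≤ n f ≡ 0
  sum-zero zero    e = e 0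
  sum-zero (suc n) e = cong₂ _+_ (sum-zero n e) (e (suc n))

  sum-truncate : ∀ {m n} (f : ℕ → ℕ) → m ≤ n → (∀ i → m < i → f i ≡ 0) → sumℕ≤ n f ≡ sumℕ≤ m f
  sum-truncate {m} f m≤n vanish = go (≤⇒≤′ m≤n)
    where
    go : ∀ {n} → m ≤′ n → sumℕ≤ n f ≡ sumℕ≤ m f
    go ≤′-refl          = refl
    go (≤′-step {n} m≤′n) =
      trans (cong₂ _+_ (go m≤′n) (vanish (suc n) (s≤s (≤′⇒≤ m≤′n)))) (+-identityʳ _)

  -- Abstracting over the summation functional lets one exchange lemma cover ranges, antidiagonals
  -- and double ranges alike. A range `0, …, n` always has at least one term, so the exchange starts
  -- from a single summand.
  Additive : {X : Set} → ((X → ℕ) → ℕ) → Set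
  Additive Λ = ∀ f g → Λ f + Λ g ≡ Λ (λ x → f x + g x)

  sum-exchange : ∀ {X} {Λ : (X → ℕ) → ℕ} → Additive Λ → ∀ n (f : ℕ → X → ℕ) →
    sumℕ≤ n (λ i → Λ (f i)) ≡ Λ (λ x → sumℕ≤ n (λ i → f i x))
  sum-exchange {Λ = Λ} add zero    f = refl
  sum-exchange {Λ = Λ} add (suc n) f = trans (cong (_+ Λ (f (suc n))) (sum-exchange {Λ = Λ} add n f)) (add _ (f (suc n)))

  -- Both indices of a pair with u + v = n are passed to the summand, which keeps convolution
  -- identities free of truncated subtraction.
  antiSum : ℕ → (ℕ → ℕ → ℕ) → ℕ
  antiSum zero    f = f 0 0
  antiSum (suc n) f = f 0 (suc n) + antiSum n (λ u v → f (suc u) v)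

  anti-cong : ∀ n {f g : ℕ → ℕ → ℕ} → (∀ u v → u + v ≡ n → f u v ≡ g u v) → antiSum n f ≡ antiSum n g
  anti-cong zero    e = e 0 0 refl
  anti-cong (suc n) e = cong₂ _+_ (e 0 (suc n) refl) (anti-cong n (λ u v p → e (suc u) v (cong suc p)))

  anti-+ : ∀ n (f g : ℕ → ℕ → ℕ) → antiSum n f + antiSum n g ≡ antiSum n (λ u v → f u v + g u v)
  anti-+ zero    f g = refl
  anti-+ (suc n) f g = trans
    (interchange (f 0 (suc n)) (antiSum n (λ u v → f (suc u) v)) (g 0 (suc n)) (antiSum n (λ u v → g (suc u) v)))
    (cong (f 0 (suc n) + g 0 (suc n) +_) (anti-+ n (λ u v → f (suc u) v) (λ u v → g (suc u) v)))

  anti-*ˡ : ∀ n c (f : ℕ → ℕ → ℕ) → c * antiSum n f ≡ antiSum n (λ u v → c * f u v)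
  anti-*ˡ zero    c f = refl
  anti-*ˡ (suc n) c f = trans (*-distribˡ-+ c (f 0 (suc n)) (antiSum n (λ u v → f (suc u) v)))
    (cong (c * f 0 (suc n) +_) (anti-*ˡ n c (λ u v → f (suc u) v)))

  anti-*ʳ : ∀ n c (f : ℕ → ℕ → ℕ) → antiSum n f * c ≡ antiSum n (λ u v → f u v * c)
  anti-*ʳ n c f = trans (*-comm (antiSum n f) c) (trans (anti-*ˡ n c f) (anti-cong n (λ u v _ → *-comm c (f u v))))

  anti-snoc : ∀ n (f : ℕ → ℕ → ℕ) → antiSum (suc n) f ≡ antiSum n (λ u v → f u (suc v)) + f (suc n) 0
  anti-snoc zero    f = refl
  anti-snoc (suc n) f = trans (cong (f 0 (suc (suc n)) +_) (anti-snoc n (λ u v → f (suc u) v)))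
    (sym (+-assoc (f 0 (suc (suc n))) (antiSum n (λ u v → f (suc u) (suc v))) (f (suc (suc n)) 0)))

  anti-diagonal : ∀ n (f : ℕ → ℕ → ℕ) → antiSum n f ≡ sumℕ≤ n (λ i → f i (n ∸ i))
  anti-diagonal zero    f = refl
  anti-diagonal (suc n) f = begin
    f 0 (suc n) + antiSum n (λ u v → f (suc u) v)                  ≡⟨ cong (f 0 (suc n) +_) (anti-diagonal n (λ u v → f (suc u) v)) ⟩
    f 0 (suc n) + sumℕ≤ n (λ i → f (suc i) (n ∸ i))             ≡⟨ sum-suc n _ ⟨
    sumℕ≤ (suc n) (λ i → f i (suc n ∸ i))                       ∎

  triangle : ∀ n (f : ℕ → ℕ → ℕ) →
    sumℕ≤ n (λ i → sumℕ≤ (n ∸ i) (f i)) ≡ sumℕ≤ n (λ m → antiSum m f)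
  triangle zero    f = refl
  triangle (suc n) f = begin
    sumℕ≤ (suc n) (λ i → sumℕ≤ (suc n ∸ i) (f i))
      ≡⟨ sum-suc n _ ⟩
    sumℕ≤ (suc n) (f 0) + sumℕ≤ n (λ i → sumℕ≤ (n ∸ i) (f (suc i)))
      ≡⟨ cong₂ _+_ (sum-suc n (f 0)) (triangle n (λ u v → f (suc u) v)) ⟩
    f 0 0 + sumℕ≤ n (λ m → f 0 (suc m)) + sumℕ≤ n (λ m → antiSum m (λ u v → f (suc u) v))
      ≡⟨ trans (+-assoc (f 0 0) _ _) (cong (f 0 0 +_) (sum-+ n _ _)) ⟩
    f 0 0 + sumℕ≤ n (λ m → antiSum (suc m) f)
      ≡⟨ sum-suc n _ ⟨
    sumℕ≤ (suc n) (λ m → antiSum m f) ∎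

  square⇒antidiagonals : ∀ n (f : ℕ → ℕ → ℕ) → (∀ i r → n < i + r → f i r ≡ 0) →
    sumℕ≤ n (λ i → sumℕ≤ n (f i)) ≡ sumℕ≤ n (λ m → antiSum m f)
  square⇒antidiagonals n f vanish = trans (sum-cong n cut) (triangle n f)
    where
    cut : ∀ i → i ≤ n → sumℕ≤ n (f i) ≡ sumℕ≤ (n ∸ i) (f i)
    cut i i≤n = sum-truncate (f i) (m∸n≤m n i) λ r n∸i<r →
      vanish i r (subst (_< i + r) (m+[n∸m]≡n i≤n) (+-monoʳ-< i n∸i<r))

  -- Binomial identities

  pascal : ∀ n k → suc n C suc k ≡ n C k + n C suc k
  pascal n k = sym (nCk+nC[k+1]≡[n+1]C[k+1] n k)

  -- Pascal's rule splits every term with u ≥ 1. One half is the sum for k; the other lacks exactly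
  -- the term u = 0 of the sum for k + 1, and the unsplit head supplies it.
  vandermonde : ∀ m n k → antiSum k (λ u v → m C u * n C v) ≡ (m + n) C k
  vandermonde zero    n zero    = refl
  vandermonde zero    n (suc k) = begin
    n C suc k + 0 + antiSum k (λ _ _ → 0) ≡⟨ cong (n C suc k + 0 +_) (sym (anti-*ˡ k 0 (λ _ _ → 0))) ⟩
    n C suc k + 0 + 0                  ≡⟨ trans (+-identityʳ _) (+-identityʳ _) ⟩
    n C suc k                          ∎
  vandermonde (suc m) n zero    = refl
  vandermonde (suc m) n (suc k) = begin
    n C suc k + 0 + antiSum k (λ u v → suc m C suc u * n C v)
      ≡⟨ cong (n C suc k + 0 +_) (anti-cong k λ u v _ →
           trans (cong (_* n C v) (pascal m u)) (*-distribʳ-+ (n C v) (m C u) _)) ⟩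
    n C suc k + 0 + antiSum k (λ u v → m C u * n C v + m C suc u * n C v)
      ≡⟨ cong (n C suc k + 0 +_) (sym (anti-+ k _ _)) ⟩
    n C suc k + 0 + (antiSum k (λ u v → m C u * n C v) + antiSum k (λ u v → m C suc u * n C v))
      ≡⟨ rearrange (n C suc k + 0) (antiSum k (λ u v → m C u * n C v)) (antiSum k (λ u v → m C suc u * n C v)) ⟩
    antiSum k (λ u v → m C u * n C v) + antiSum (suc k) (λ u v → m C u * n C v)
      ≡⟨ cong₂ _+_ (vandermonde m n k) (vandermonde m n (suc k)) ⟩
    (m + n) C k + (m + n) C suc k
      ≡⟨ pascal (m + n) k ⟨
    suc (m + n) C suc k ∎
    where
    rearrange : ∀ a b c → a + (b + c) ≡ b + (a + c)
    rearrange = solve-∀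

  -- Choose k + l + 1 of the numbers 0, ..., n and let u be the (k+1)-st smallest of them: k chosen
  -- numbers lie among the u below it, l among the v above it.
  upperConvolution : ∀ n k l → antiSum n (λ u v → u C k * v C l) ≡ suc n C suc (k + l)
  upperConvolution zero    zero    zero    = refl
  upperConvolution zero    zero    (suc l) = sym (k>n⇒nCk≡0 {1} {suc (suc l)} (s≤s (s≤s z≤n)))
  upperConvolution zero    (suc k) l       = sym (k>n⇒nCk≡0 {1} {suc (suc k + l)} (s≤s (s≤s z≤n)))
  upperConvolution (suc n) zero    l       = begin
    suc n C l + 0 + antiSum n (λ u v → 1 * v C l)   ≡⟨ cong₂ _+_ (+-identityʳ (suc n C l)) (upperConvolution n 0 l) ⟩
    suc n C l + suc n C suc l                    ≡⟨ pascal (suc n) l ⟨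
    suc (suc n) C suc l                          ∎
  upperConvolution (suc n) (suc k) l       = begin
    antiSum n (λ u v → suc u C suc k * v C l)
      ≡⟨ anti-cong n (λ u v _ → trans (cong (_* v C l) (pascal u k)) (*-distribʳ-+ (v C l) (u C k) _)) ⟩
    antiSum n (λ u v → u C k * v C l + u C suc k * v C l)
      ≡⟨ anti-+ n _ _ ⟨
    antiSum n (λ u v → u C k * v C l) + antiSum n (λ u v → u C suc k * v C l)
      ≡⟨ cong₂ _+_ (upperConvolution n k l) (upperConvolution n (suc k) l) ⟩
    suc n C suc (k + l) + suc n C suc (suc k + l)
      ≡⟨ pascal (suc n) (suc (k + l)) ⟨
    suc (suc n) C suc (suc k + l) ∎

  -- The longer antidiagonal has only j further terms, those with first index below j, and they
  -- vanish. It removes the shifts in upper indices of binomials whose lower index is at least the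
  -- shift.
  anti-dropˡ : ∀ j n (f : ℕ → ℕ → ℕ) → (∀ u v → u < j → f u v ≡ 0) →
    antiSum n (λ u v → f (u + j) v) ≡ antiSum (n + j) f
  anti-dropˡ zero    n f vanish = trans
    (anti-cong n (λ u v _ → cong (λ w → f w v) (+-identityʳ u)))
    (cong (λ m → antiSum m f) (sym (+-identityʳ n)))
  anti-dropˡ (suc j) n f vanish = begin
    antiSum n (λ u v → f (u + suc j) v)                    ≡⟨ anti-cong n (λ u v _ → cong (λ w → f w v) (+-suc u j)) ⟩
    antiSum n (λ u v → f (suc (u + j)) v)                  ≡⟨ anti-dropˡ j n (λ u v → f (suc u) v) (λ u v u<j → vanish (suc u) v (s≤s u<j)) ⟩
    antiSum (n + j) (λ u v → f (suc u) v)                  ≡⟨ cong (_+ antiSum (n + j) (λ u v → f (suc u) v)) (vanish 0 (suc (n + j)) z<s) ⟨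
    antiSum (suc (n + j)) f                                ≡⟨ cong (λ m → antiSum m f) (+-suc n j) ⟨
    antiSum (n + suc j) f                                  ∎

  anti-dropʳ : ∀ k n (f : ℕ → ℕ → ℕ) → (∀ u v → v < k → f u v ≡ 0) →
    antiSum n (λ u v → f u (v + k)) ≡ antiSum (n + k) f
  anti-dropʳ zero    n f vanish = trans
    (anti-cong n (λ u v _ → cong (f u) (+-identityʳ v)))
    (cong (λ m → antiSum m f) (sym (+-identityʳ n)))
  anti-dropʳ (suc k) n f vanish = begin
    antiSum n (λ u v → f u (v + suc k))                    ≡⟨ anti-cong n (λ u v _ → cong (f u) (+-suc v k)) ⟩
    antiSum n (λ u v → f u (suc (v + k)))                  ≡⟨ anti-dropʳ k n (λ u v → f u (suc v)) (λ u v v<k → vanish u (suc v) (s≤s v<k)) ⟩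
    antiSum (n + k) (λ u v → f u (suc v))                  ≡⟨ +-identityʳ _ ⟨
    antiSum (n + k) (λ u v → f u (suc v)) + 0              ≡⟨ cong (antiSum (n + k) (λ u v → f u (suc v)) +_) (vanish (suc (n + k)) 0 z<s) ⟨
    antiSum (n + k) (λ u v → f u (suc v)) + f (suc (n + k)) 0 ≡⟨ anti-snoc (n + k) f ⟨
    antiSum (suc (n + k)) f                                ≡⟨ cong (λ m → antiSum m f) (+-suc n k) ⟨
    antiSum (n + suc k) f                                  ∎

  shiftedConvolution : ∀ n j k p q →
    antiSum n (λ u v → (u + j) C (j + p) * (v + k) C (k + q)) ≡ suc (n + j + k) C suc (j + p + (k + q))
  shiftedConvolution n j k p q = begin
    antiSum n (λ u v → (u + j) C (j + p) * (v + k) C (k + q))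
      ≡⟨ anti-dropˡ j n (λ u v → u C (j + p) * (v + k) C (k + q))
           (λ u v u<j → cong (_* (v + k) C (k + q)) (k>n⇒nCk≡0 (<-≤-trans u<j (m≤m+n j p)))) ⟩
    antiSum (n + j) (λ u v → u C (j + p) * (v + k) C (k + q))
      ≡⟨ anti-dropʳ k (n + j) (λ u v → u C (j + p) * v C (k + q))
           (λ u v v<k → trans (cong (u C (j + p) *_) (k>n⇒nCk≡0 (<-≤-trans v<k (m≤m+n k q)))) (*-zeroʳ (u C (j + p)))) ⟩
    antiSum (n + j + k) (λ u v → u C (j + p) * v C (k + q))
      ≡⟨ upperConvolution (n + j + k) (j + p) (k + q) ⟩
    suc (n + j + k) C suc (j + p + (k + q)) ∎

  hockeyStick : ∀ n j → antiSum n (λ _ u → (u + j) C j) ≡ suc (n + j) C suc j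
  hockeyStick n j = begin
    antiSum n (λ _ u → (u + j) C j)
      ≡⟨ anti-cong n (λ u v _ → trans (cong ((v + j) C_) (sym (+-identityʳ j))) (sym (+-identityʳ _))) ⟩
    antiSum n (λ u v → (u + 0) C (0 + 0) * (v + j) C (j + 0))
      ≡⟨ shiftedConvolution n 0 j 0 0 ⟩
    suc (n + 0 + j) C suc (j + 0)
      ≡⟨ cong₂ (λ m l → suc (m + j) C suc l) (+-identityʳ n) (+-identityʳ j) ⟩
    suc (n + j) C suc j ∎

  C*!*! : ∀ m n → (m + n) C m * (m ! * n !) ≡ (m + n) !
  C*!*! m n = begin
    (m + n) C m * (m ! * n !)
      ≡⟨ cong (λ l → (m + n) C m * (m ! * l !)) (m+n∸m≡n m n) ⟨
    (m + n) C m * (m ! * (m + n ∸ m) !)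
      ≡⟨ cong (_* (m ! * (m + n ∸ m) !)) (nCk≡n!/k![n-k]! (m≤m+n m n)) ⟩
    ((m + n) ! / (m ! * (m + n ∸ m) !)) * (m ! * (m + n ∸ m) !)
      ≡⟨ m/n*n≡m (k![n∸k]!∣n! (m≤m+n m n)) ⟩
    (m + n) ! ∎
    where instance _ = m !* (m + n ∸ m) !≢0

  -- Both sides are the multinomial coefficient (j+k+e)! / (j! k! e!), compared after clearing the
  -- denominator.
  trinomialRevision-+ : ∀ j k e → (j + (k + e)) C j * (k + e) C k ≡ (j + k + e) C (j + k) * (j + k) C j
  trinomialRevision-+ j k e = *-cancelʳ-≡ _ _ (j ! * k ! * e !) (begin
    (j + (k + e)) C j * (k + e) C k * (j ! * k ! * e !)
      ≡⟨ regroup₁ ((j + (k + e)) C j) ((k + e) C k) (j !) (k !) (e !) ⟩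
    (j + (k + e)) C j * (j ! * ((k + e) C k * (k ! * e !)))
      ≡⟨ cong (λ x → (j + (k + e)) C j * (j ! * x)) (C*!*! k e) ⟩
    (j + (k + e)) C j * (j ! * (k + e) !)
      ≡⟨ C*!*! j (k + e) ⟩
    (j + (k + e)) !
      ≡⟨ cong _! (+-assoc j k e) ⟨
    (j + k + e) !
      ≡⟨ C*!*! (j + k) e ⟨
    (j + k + e) C (j + k) * ((j + k) ! * e !)
      ≡⟨ cong (λ x → (j + k + e) C (j + k) * (x * e !)) (C*!*! j k) ⟨
    (j + k + e) C (j + k) * ((j + k) C j * (j ! * k !) * e !)
      ≡⟨ regroup₂ ((j + k + e) C (j + k)) ((j + k) C j) (j !) (k !) (e !) ⟩
    (j + k + e) C (j + k) * (j + k) C j * (j ! * k ! * e !) ∎)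
    where
    instance
      _ = m*n≢0 (j ! * k !) (e !) {{ j !* k !≢0 }} {{ e !≢0 }}
    regroup₁ : ∀ x y a b c → x * y * (a * b * c) ≡ x * (a * (y * (b * c)))
    regroup₁ = solve-∀
    regroup₂ : ∀ x y a b c → x * (y * (a * b) * c) ≡ x * y * (a * b * c)
    regroup₂ = solve-∀

  -- Two binomials that depend on n become one, times a constant. Only in this form can a sum over n
  -- be evaluated by a convolution.
  trinomialRevision : ∀ n j k → (n + j) C j * n C k ≡ (n + j) C (j + k) * (j + k) C j
  trinomialRevision n j k with k ≤? n
  ... | no k≰n = begin
    (n + j) C j * n C k                   ≡⟨ cong ((n + j) C j *_) (k>n⇒nCk≡0 (≰⇒> k≰n)) ⟩
    (n + j) C j * 0                       ≡⟨ *-zeroʳ ((n + j) C j) ⟩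
    0                                     ≡⟨ cong (_* (j + k) C j) (k>n⇒nCk≡0 n+j<j+k) ⟨
    (n + j) C (j + k) * (j + k) C j       ∎
    where
    n+j<j+k : n + j < j + k
    n+j<j+k = subst (_< j + k) (+-comm j n) (+-monoʳ-< j (≰⇒> k≰n))
  ... | yes k≤n = begin
    (n + j) C j * n C k                   ≡⟨ cong₂ (λ m l → m C j * l C k) n+j≡ (sym (m+[n∸m]≡n k≤n)) ⟩
    (j + (k + e)) C j * (k + e) C k       ≡⟨ trinomialRevision-+ j k e ⟩
    (j + k + e) C (j + k) * (j + k) C j   ≡⟨ cong (λ m → m C (j + k) * (j + k) C j) (trans (+-assoc j k e) (sym n+j≡)) ⟩
    (n + j) C (j + k) * (j + k) C j       ∎
    where
    e = n ∸ k
    n+j≡ : n + j ≡ j + (k + e)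
    n+j≡ = trans (+-comm n j) (cong (j +_) (sym (m+[n∸m]≡n k≤n)))

  subsetOfSubset : ∀ n i r → n C i * (n ∸ i) C r ≡ n C (i + r) * (i + r) C i
  subsetOfSubset n i r with i ≤? n
  ... | yes i≤n = subst (λ m → m C i * (n ∸ i) C r ≡ m C (i + r) * (i + r) C i)
                    (m∸n+n≡m i≤n) (trinomialRevision (n ∸ i) i r)
  ... | no  i≰n = trans (cong (_* (n ∸ i) C r) (k>n⇒nCk≡0 (≰⇒> i≰n)))
                    (cong (_* (i + r) C i) (sym (k>n⇒nCk≡0 (<-≤-trans (≰⇒> i≰n) (m≤m+n i r)))))

  -- Vandermonde after replacing `j C i` by `j C (j ∸ i)`. The upper limit may be any n ≥ min(j, k),
  -- so that one common range can serve all words at once.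
  commonSubsets : ∀ j k n → j ⊓ k ≤ n → sumℕ≤ n (λ i → j C i * k C i) ≡ (j + k) C j
  commonSubsets j k n j⊓k≤n = begin
    sumℕ≤ n (λ i → j C i * k C i)            ≡⟨ sum-truncate _ j⊓k≤n vanish ⟩
    sumℕ≤ (j ⊓ k) (λ i → j C i * k C i)      ≡⟨ sum-truncate _ (m⊓n≤m j k) vanish ⟨
    sumℕ≤ j (λ i → j C i * k C i)            ≡⟨ sum-cong j (λ i i≤j → trans (*-comm (j C i) _)
                                                  (cong (k C i *_) (nCk≡nC[n∸k] i≤j))) ⟩
    sumℕ≤ j (λ i → k C i * j C (j ∸ i))      ≡⟨ anti-diagonal j (λ u v → k C u * j C v) ⟨
    antiSum j (λ u v → k C u * j C v)           ≡⟨ vandermonde k j j ⟩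
    (k + j) C j                              ≡⟨ cong (_C j) (+-comm k j) ⟩
    (j + k) C j                              ∎
    where
    vanish : ∀ i → j ⊓ k < i → j C i * k C i ≡ 0
    vanish i j⊓k<i with j <? i
    ... | yes j<i = cong (_* k C i) (k>n⇒nCk≡0 j<i)
    ... | no  j≮i = trans (cong (j C i *_) (k>n⇒nCk≡0 (≰⇒> λ i≤k → <⇒≱ j⊓k<i (⊓-glb (≮⇒≥ j≮i) i≤k)))) (*-zeroʳ (j C i))

  centralBinomial : ∀ m → antiSum m (λ i r → (i + r) C i * (i + r) C r) ≡ (2 * m) C m
  centralBinomial m = begin
    antiSum m (λ i r → (i + r) C i * (i + r) C r) ≡⟨ anti-cong m (λ i r i+r≡m → cong (λ s → s C i * s C r) i+r≡m) ⟩
    antiSum m (λ i r → m C i * m C r)             ≡⟨ vandermonde m m m ⟩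
    (m + m) C m                                ≡⟨ cong (λ l → (m + l) C m) (+-identityʳ m) ⟨
    (2 * m) C m                                ∎

  -- Weighted sums over two-letter words

  -- Sums f (#x) (#y) over the words of length a in the letters x and y, so equals Σ_{j+j′=a} (a choose j) f(j,j′).
  wordSum : ℕ → (ℕ → ℕ → ℕ) → ℕ
  wordSum zero    f = f 0 0
  wordSum (suc a) f = wordSum a (λ j j′ → f (suc j) j′ + f j (suc j′))

  wordSum-cong : ∀ a {f g : ℕ → ℕ → ℕ} → (∀ j j′ → j + j′ ≡ a → f j j′ ≡ g j j′) → wordSum a f ≡ wordSum a g
  wordSum-cong zero    e = e 0 0 refl
  wordSum-cong (suc a) e = wordSum-cong a λ j j′ p →
    cong₂ _+_ (e (suc j) j′ (cong suc p)) (e j (suc j′) (trans (+-suc j j′) (cong suc p)))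

  wordSum-cong′ : ∀ a {f g : ℕ → ℕ → ℕ} → (∀ j j′ → f j j′ ≡ g j j′) → wordSum a f ≡ wordSum a g
  wordSum-cong′ a e = wordSum-cong a λ j j′ _ → e j j′

  wordSum-exchange : ∀ {X} {Λ : (X → ℕ) → ℕ} → Additive Λ → ∀ a (f : ℕ → ℕ → X → ℕ) →
    wordSum a (λ j j′ → Λ (f j j′)) ≡ Λ (λ x → wordSum a (λ j j′ → f j j′ x))
  wordSum-exchange add zero    f = refl
  wordSum-exchange {Λ = Λ} add (suc a) f =
    trans (wordSum-cong′ a (λ j j′ → add (f (suc j) j′) (f j (suc j′)))) (wordSum-exchange {Λ = Λ} add a _)

  wordSum-+ : ∀ a (f g : ℕ → ℕ → ℕ) → wordSum a f + wordSum a g ≡ wordSum a (λ j j′ → f j j′ + g j j′)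
  wordSum-+ zero    f g = refl
  wordSum-+ (suc a) f g = trans (wordSum-+ a _ _)
    (wordSum-cong′ a (λ j j′ → interchange (f (suc j) j′) (f j (suc j′)) (g (suc j) j′) (g j (suc j′))))

  wordSum-*ˡ : ∀ a c (f : ℕ → ℕ → ℕ) → c * wordSum a f ≡ wordSum a (λ j j′ → c * f j j′)
  wordSum-*ˡ zero    c f = refl
  wordSum-*ˡ (suc a) c f = trans (wordSum-*ˡ a c _) (wordSum-cong′ a (λ j j′ → *-distribˡ-+ c (f (suc j) j′) (f j (suc j′))))

  wordSum-*ʳ : ∀ a c (f : ℕ → ℕ → ℕ) → wordSum a f * c ≡ wordSum a (λ j j′ → f j j′ * c)
  wordSum-*ʳ a c f = trans (*-comm (wordSum a f) c)
    (trans (wordSum-*ˡ a c f) (wordSum-cong′ a (λ j j′ → *-comm c (f j j′))))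

  wordSum-swap : ∀ a (f : ℕ → ℕ → ℕ) → wordSum a f ≡ wordSum a (λ j j′ → f j′ j)
  wordSum-swap zero    f = refl
  wordSum-swap (suc a) f = trans (wordSum-swap a _) (wordSum-cong′ a (λ j j′ → +-comm (f (suc j′) j) (f j′ (suc j))))

  -- Concatenation makes a word of length a + b out of the two words, and the numbers of second
  -- letters add.
  wordSum-merge : ∀ a b (h : ℕ → ℕ) →
    wordSum a (λ _ j → wordSum b (λ _ k → h (j + k))) ≡ wordSum (a + b) (λ _ l → h l)
  wordSum-merge zero    b h = refl
  wordSum-merge (suc a) b h = trans
    (wordSum-cong′ a (λ _ j → wordSum-+ b (λ _ k → h (j + k)) (λ _ k → h (suc (j + k)))))
    (wordSum-merge a b (λ l → h l + h (suc l)))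

  -- Marking i of the letters x in a word amounts to choosing i of the a positions for marked
  -- letters x and filling the other positions freely.
  markˡ : ∀ a i (g : ℕ → ℕ → ℕ) →
    wordSum a (λ j j′ → j C i * g j j′) ≡ a C i * wordSum (a ∸ i) (λ j j′ → g (i + j) j′)
  markˡ a       zero    g = trans (wordSum-cong′ a (λ j j′ → +-identityʳ (g j j′))) (sym (+-identityʳ (wordSum a g)))
  markˡ zero    (suc i) g = refl
  markˡ (suc a) (suc i) g = begin
    wordSum a (λ j j′ → suc j C suc i * g (suc j) j′ + j C suc i * g j (suc j′))
      ≡⟨ wordSum-cong′ a (λ j j′ → trans
           (cong (λ c → c * g (suc j) j′ + j C suc i * g j (suc j′)) (pascal j i))
           (regroup (j C i) (j C suc i) (g (suc j) j′) (g j (suc j′)))) ⟩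
    wordSum a (λ j j′ → j C i * g (suc j) j′ + j C suc i * (g (suc j) j′ + g j (suc j′)))
      ≡⟨ wordSum-+ a _ _ ⟨
    wordSum a (λ j j′ → j C i * g (suc j) j′) + wordSum a (λ j j′ → j C suc i * (g (suc j) j′ + g j (suc j′)))
      ≡⟨ cong₂ _+_ (markˡ a i (λ j → g (suc j))) (markˡ a (suc i) (λ j j′ → g (suc j) j′ + g j (suc j′))) ⟩
    a C i * wordSum (a ∸ i) h + a C suc i * wordSum (a ∸ suc i) (λ j j′ → g (suc (suc i + j)) j′ + h j (suc j′))
      ≡⟨ cong (λ w → a C i * wordSum (a ∸ i) h + a C suc i * w)
           (wordSum-cong′ (a ∸ suc i) (λ j j′ → cong (λ s → g (suc s) j′ + h j (suc j′)) (sym (+-suc i j)))) ⟩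
    a C i * wordSum (a ∸ i) h + a C suc i * wordSum (suc (a ∸ suc i)) h
      ≡⟨ cong (a C i * wordSum (a ∸ i) h +_) lengthen ⟩
    a C i * wordSum (a ∸ i) h + a C suc i * wordSum (a ∸ i) h
      ≡⟨ *-distribʳ-+ (wordSum (a ∸ i) h) (a C i) (a C suc i) ⟨
    (a C i + a C suc i) * wordSum (a ∸ i) h
      ≡⟨ cong (_* wordSum (a ∸ i) h) (pascal a i) ⟨
    suc a C suc i * wordSum (a ∸ i) h ∎
    where
    h : ℕ → ℕ → ℕ
    h j j′ = g (suc i + j) j′
    regroup : ∀ p q x y → (p + q) * x + q * y ≡ p * x + q * (x + y)
    regroup = solve-∀
    -- `suc (a ∸ suc i)` equals `a ∸ i` only for i < a; otherwise truncation breaks the equality,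
    -- but the factor `a C suc i` is zero.
    lengthen : a C suc i * wordSum (suc (a ∸ suc i)) h ≡ a C suc i * wordSum (a ∸ i) h
    lengthen with suc i ≤? a
    ... | yes i<a = cong (λ m → a C suc i * wordSum m h) (sym (+-∸-assoc 1 i<a))
    ... | no  i≮a = trans (cong (_* wordSum (suc (a ∸ suc i)) h) (k>n⇒nCk≡0 (≰⇒> i≮a)))
                          (cong (_* wordSum (a ∸ i) h) (sym (k>n⇒nCk≡0 (≰⇒> i≮a))))

  markʳ : ∀ a i (g : ℕ → ℕ → ℕ) →
    wordSum a (λ j j′ → j′ C i * g j j′) ≡ a C i * wordSum (a ∸ i) (λ j j′ → g j (i + j′))
  markʳ a i g = trans (wordSum-swap a _) (trans (markˡ a i (λ j j′ → g j′ j))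
    (cong (a C i *_) (wordSum-swap (a ∸ i) _)))

  -- The marked positions form a set of size i + r, of which i carry the letter x and r the letter
  -- y; the other positions are free.
  markBoth : ∀ a i r (g : ℕ → ℕ) →
    wordSum a (λ j j′ → j C i * (j′ C r * g j′)) ≡
    a C (i + r) * (i + r) C i * wordSum (a ∸ (i + r)) (λ _ j′ → g (r + j′))
  markBoth a i r g = begin
    wordSum a (λ j j′ → j C i * (j′ C r * g j′))
      ≡⟨ markˡ a i (λ _ j′ → j′ C r * g j′) ⟩
    a C i * wordSum (a ∸ i) (λ _ j′ → j′ C r * g j′)
      ≡⟨ cong (a C i *_) (markʳ (a ∸ i) r (λ _ j′ → g j′)) ⟩
    a C i * ((a ∸ i) C r * wordSum (a ∸ i ∸ r) (λ _ j′ → g (r + j′)))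
      ≡⟨ *-assoc (a C i) ((a ∸ i) C r) _ ⟨
    a C i * (a ∸ i) C r * wordSum (a ∸ i ∸ r) (λ _ j′ → g (r + j′))
      ≡⟨ cong₂ (λ c e → c * wordSum e (λ _ j′ → g (r + j′))) (subsetOfSubset a i r) (∸-+-assoc a i r) ⟩
    a C (i + r) * (i + r) C i * wordSum (a ∸ (i + r)) (λ _ j′ → g (r + j′)) ∎

  -- The γ-expansion of the double word sum

  pairSum-additive : ∀ n → Additive {ℕ × ℕ} (λ f → sumℕ≤ n (λ i → sumℕ≤ n (λ r → f (i , r))))
  pairSum-additive n f g = trans (sum-+ n _ _) (sum-cong n λ i _ → sum-+ n _ _)

  γ-coefficient : ℕ → ℕ → ℕ → ℕ
  γ-coefficient a b i = (2 * i) C i * a C i * b C i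

  -- This is an identity of polynomials in t, stated without polynomials: `T l` plays the value of
  -- an arbitrary linear functional at t^l, and `wordSum e (λ _ l → T (m + l))` is then its value at
  -- t^m (1+t)^e.
  γ-expansion : ∀ a b (T : ℕ → ℕ) →
    wordSum a (λ j j′ → wordSum b (λ k k′ → (j + k′) C j * (k + j′) C k * T (j′ + k′))) ≡
    sumℕ≤ (a ⊓ b) (λ m → γ-coefficient a b m * wordSum (a + b ∸ 2 * m) (λ _ l → T (m + l)))
  γ-expansion a b T = begin
    wordSum a (λ j j′ → wordSum b (λ k k′ → (j + k′) C j * (k + j′) C k * T (j′ + k′)))
      ≡⟨ wordSum-cong a (λ j j′ p → wordSum-cong b (λ k k′ q → expand j j′ k k′ p q)) ⟩
    wordSum a (λ j j′ → wordSum b (λ k k′ → Λ (term j j′ k k′)))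
      ≡⟨ wordSum-cong′ a (λ j j′ → wordSum-exchange {Λ = Λ} (pairSum-additive M) b (term j j′)) ⟩
    wordSum a (λ j j′ → Λ (λ ir → wordSum b (λ k k′ → term j j′ k k′ ir)))
      ≡⟨ wordSum-exchange {Λ = Λ} (pairSum-additive M) a (λ j j′ ir → wordSum b (λ k k′ → term j j′ k k′ ir)) ⟩
    Λ (λ ir → wordSum a (λ j j′ → wordSum b (λ k k′ → term j j′ k k′ ir)))
      ≡⟨ sum-cong M (λ i _ → sum-cong M (λ r _ → collect i r)) ⟩
    sumℕ≤ M (λ i → sumℕ≤ M (λ r → f (i + r) * ((i + r) C i * (i + r) C r)))
      -- For i + r > min(a, b) one of `a C (i + r)` and `b C (i + r)` is zero, so the square of
      -- pairs may be cut down to its antidiagonals up to `M`.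
      ≡⟨ square⇒antidiagonals M _ (λ i r M<i+r → cong (_* ((i + r) C i * (i + r) C r)) (f-vanishes (i + r) M<i+r)) ⟩
    sumℕ≤ M (λ m → antiSum m (λ i r → f (i + r) * ((i + r) C i * (i + r) C r)))
      ≡⟨ sum-cong M finish ⟩
    sumℕ≤ M (λ m → γ-coefficient a b m * wordSum (a + b ∸ 2 * m) (λ _ l → T (m + l))) ∎
    where
    M = a ⊓ b
    Λ : (ℕ × ℕ → ℕ) → ℕ
    Λ f = sumℕ≤ M (λ i → sumℕ≤ M (λ r → f (i , r)))
    term : ℕ → ℕ → ℕ → ℕ → ℕ × ℕ → ℕ
    term j j′ k k′ (i , r) = j C i * (j′ C r * (k C r * (k′ C i * T (j′ + k′))))
    f : ℕ → ℕ
    f m = a C m * b C m * wordSum ((a ∸ m) + (b ∸ m)) (λ _ l → T (m + l))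

    f-vanishes : ∀ m → M < m → f m ≡ 0
    f-vanishes m M<m with a <? m
    ... | yes a<m = cong (λ c → c * b C m * wordSum ((a ∸ m) + (b ∸ m)) (λ _ l → T (m + l))) (k>n⇒nCk≡0 a<m)
    ... | no  a≮m = cong (_* wordSum ((a ∸ m) + (b ∸ m)) (λ _ l → T (m + l))) (trans
      (cong (a C m *_) (k>n⇒nCk≡0 (≰⇒> λ m≤b → <⇒≱ M<m (⊓-glb (≮⇒≥ a≮m) m≤b)))) (*-zeroʳ (a C m)))

    expand : ∀ j j′ k k′ → j + j′ ≡ a → k + k′ ≡ b →
      (j + k′) C j * (k + j′) C k * T (j′ + k′) ≡ Λ (term j j′ k k′)
    expand j j′ k k′ refl refl = begin
      (j + k′) C j * (k + j′) C k * t
        ≡⟨ cong₂ (λ x y → x * y * t)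
             (commonSubsets j k′ M (⊓-mono-≤ (m≤m+n j j′) (m≤n+m k′ k)))
             (commonSubsets k j′ M (subst (k ⊓ j′ ≤_) (⊓-comm b a) (⊓-mono-≤ (m≤m+n k k′) (m≤n+m j′ j)))) ⟨
      sumℕ≤ M (λ i → j C i * k′ C i) * sumℕ≤ M (λ r → k C r * j′ C r) * t
        ≡⟨ cong (_* t) (sum-*ʳ M (sumℕ≤ M (λ r → k C r * j′ C r)) (λ i → j C i * k′ C i)) ⟩
      sumℕ≤ M (λ i → j C i * k′ C i * sumℕ≤ M (λ r → k C r * j′ C r)) * t
        ≡⟨ sum-*ʳ M t _ ⟩
      sumℕ≤ M (λ i → j C i * k′ C i * sumℕ≤ M (λ r → k C r * j′ C r) * t)
        ≡⟨ sum-cong M (λ i _ → trans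
             (cong (_* t) (sum-*ˡ M (j C i * k′ C i) (λ r → k C r * j′ C r)))
             (sum-*ʳ M t _)) ⟩
      sumℕ≤ M (λ i → sumℕ≤ M (λ r → j C i * k′ C i * (k C r * j′ C r) * t))
        ≡⟨ sum-cong M (λ i _ → sum-cong M (λ r _ → reorder (j C i) (k′ C i) (k C r) (j′ C r) t)) ⟩
      Λ (term j j′ k k′) ∎
      where
      t = T (j′ + k′)
      reorder : ∀ x y z w t → x * y * (z * w) * t ≡ x * (w * (z * (y * t)))
      reorder = solve-∀

    -- The four binomials mark letters: i letters x and r letters y in the first word, r letters x
    -- and i letters y in the second. Both words thus lose i + r positions, and the marked letters y
    -- contribute r + i to the exponent of t.
    collect : ∀ i r → wordSum a (λ j j′ → wordSum b (λ k k′ → term j j′ k k′ (i , r))) ≡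
      f (i + r) * ((i + r) C i * (i + r) C r)
    collect i r = begin
      wordSum a (λ j j′ → wordSum b (λ k k′ → term j j′ k k′ (i , r)))
        ≡⟨ wordSum-cong′ a (λ j j′ → sym (trans
             (cong (j C i *_) (wordSum-*ˡ b (j′ C r) (λ k k′ → k C r * (k′ C i * T (j′ + k′)))))
             (wordSum-*ˡ b (j C i) (λ k k′ → j′ C r * (k C r * (k′ C i * T (j′ + k′))))))) ⟩
      wordSum a (λ j j′ → j C i * (j′ C r * wordSum b (λ k k′ → k C r * (k′ C i * T (j′ + k′)))))
        ≡⟨ markBoth a i r (λ j′ → wordSum b (λ k k′ → k C r * (k′ C i * T (j′ + k′)))) ⟩
      ca * wordSum (a ∸ (i + r)) (λ _ j′ → wordSum b (λ k k′ → k C r * (k′ C i * T (r + j′ + k′))))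
        ≡⟨ cong (ca *_) (wordSum-cong′ (a ∸ (i + r)) (λ _ j′ → markBoth b r i (λ k′ → T (r + j′ + k′)))) ⟩
      ca * wordSum (a ∸ (i + r)) (λ _ j′ → cb * wordSum (b ∸ (r + i)) (λ _ k′ → T (r + j′ + (i + k′))))
        ≡⟨ cong (ca *_) (wordSum-*ˡ (a ∸ (i + r)) cb _) ⟨
      ca * (cb * wordSum (a ∸ (i + r)) (λ _ j′ → wordSum (b ∸ (r + i)) (λ _ k′ → T (r + j′ + (i + k′)))))
        ≡⟨ cong (λ w → ca * (cb * w)) (wordSum-cong′ (a ∸ (i + r)) (λ _ j′ →
             wordSum-cong′ (b ∸ (r + i)) (λ _ k′ → cong T (shuffle r j′ i k′)))) ⟩
      ca * (cb * wordSum (a ∸ (i + r)) (λ _ j′ → wordSum (b ∸ (r + i)) (λ _ k′ → T (i + r + (j′ + k′)))))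
        ≡⟨ cong (λ w → ca * (cb * w)) (wordSum-merge (a ∸ (i + r)) (b ∸ (r + i)) (λ l → T (i + r + l))) ⟩
      ca * (cb * wordSum ((a ∸ (i + r)) + (b ∸ (r + i))) (λ _ l → T (i + r + l)))
        ≡⟨ cong (λ s → ca * (b C s * s C r * wordSum ((a ∸ (i + r)) + (b ∸ s)) (λ _ l → T (i + r + l)))) (+-comm r i) ⟩
      ca * (b C (i + r) * (i + r) C r * wordSum ((a ∸ (i + r)) + (b ∸ (i + r))) (λ _ l → T (i + r + l)))
        ≡⟨ reorder (a C (i + r)) ((i + r) C i) (b C (i + r)) ((i + r) C r) _ ⟩
      f (i + r) * ((i + r) C i * (i + r) C r) ∎
      where
      ca = a C (i + r) * (i + r) C i
      cb = b C (r + i) * (r + i) C r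
      shuffle : ∀ r j i k → r + j + (i + k) ≡ i + r + (j + k)
      shuffle = solve-∀
      reorder : ∀ x y z w t → x * y * (z * w * t) ≡ x * z * t * (y * w)
      reorder = solve-∀

    finish : ∀ m → m ≤ M → antiSum m (λ i r → f (i + r) * ((i + r) C i * (i + r) C r)) ≡
      γ-coefficient a b m * wordSum (a + b ∸ 2 * m) (λ _ l → T (m + l))
    finish m m≤M = begin
      antiSum m (λ i r → f (i + r) * ((i + r) C i * (i + r) C r))
        ≡⟨ anti-cong m (λ i r p → cong (λ s → f s * ((i + r) C i * (i + r) C r)) p) ⟩
      antiSum m (λ i r → f m * ((i + r) C i * (i + r) C r))
        ≡⟨ anti-*ˡ m (f m) _ ⟨
      f m * antiSum m (λ i r → (i + r) C i * (i + r) C r)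
        ≡⟨ cong (f m *_) (centralBinomial m) ⟩
      f m * (2 * m) C m
        ≡⟨ cong (λ e → a C m * b C m * wordSum e (λ _ l → T (m + l)) * (2 * m) C m) exponent ⟩
      a C m * b C m * wordSum (a + b ∸ 2 * m) (λ _ l → T (m + l)) * (2 * m) C m
        ≡⟨ reorder (a C m) (b C m) _ ((2 * m) C m) ⟩
      γ-coefficient a b m * wordSum (a + b ∸ 2 * m) (λ _ l → T (m + l)) ∎
      where
      m≤a = ≤-trans m≤M (m⊓n≤m a b)
      m≤b = ≤-trans m≤M (m⊓n≤n a b)
      exponent : (a ∸ m) + (b ∸ m) ≡ a + b ∸ 2 * m
      exponent = begin
        (a ∸ m) + (b ∸ m)   ≡⟨ +-∸-comm (b ∸ m) m≤a ⟨
        a + (b ∸ m) ∸ m     ≡⟨ cong (_∸ m) (+-∸-assoc a m≤b) ⟨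
        a + b ∸ m ∸ m       ≡⟨ ∸-+-assoc (a + b) m m ⟩
        a + b ∸ (m + m)     ≡⟨ cong (λ l → a + b ∸ (m + l)) (+-identityʳ m) ⟨
        a + b ∸ 2 * m       ∎
      reorder : ∀ x y w z → x * y * w * z ≡ z * x * y * w
      reorder = solve-∀

  -- Counting vectors by signed sums, and pairs of vectors

  anti-additive : ∀ n → Additive {ℕ × ℕ} (λ f → antiSum n (λ u v → f (u , v)))
  anti-additive n f g = anti-+ n _ _

  wordSum-anti : ∀ a n (f : ℕ → ℕ → ℕ → ℕ → ℕ) →
    wordSum a (λ j j′ → antiSum n (f j j′)) ≡ antiSum n (λ u v → wordSum a (λ j j′ → f j j′ u v))
  wordSum-anti a n f = wordSum-exchange {Λ = λ g → antiSum n (λ u v → g (u , v))} (anti-additive n) a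
    (λ j j′ → uncurry (f j j′))

  -- Coefficient of x^U y^V in (1-xy)^a / ((1-x)(1-y))^{a+1} = (1/(1-x) + y/(1-y))^a / ((1-x)(1-y)).
  signedCount : ℕ → ℕ → ℕ → ℕ
  signedCount a U V = wordSum a (λ j j′ → (U + j) C j * V C j′)

  -- A nonnegative first entry leaves any u between 0 and U for the tail. The hockey stick identity
  -- then raises j by one, as if a letter x were added to the word.
  nonnegativeHeads : ∀ a U V →
    antiSum U (λ _ u → signedCount a u V) ≡ wordSum a (λ j j′ → (U + suc j) C suc j * V C j′)
  nonnegativeHeads a U V = begin
    antiSum U (λ _ u → signedCount a u V)
      ≡⟨ wordSum-anti a U (λ j j′ _ u → (u + j) C j * V C j′) ⟨
    wordSum a (λ j j′ → antiSum U (λ _ u → (u + j) C j * V C j′))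
      ≡⟨ wordSum-cong′ a (λ j j′ → anti-*ʳ U (V C j′) (λ _ u → (u + j) C j)) ⟨
    wordSum a (λ j j′ → antiSum U (λ _ u → (u + j) C j) * V C j′)
      ≡⟨ wordSum-cong′ a (λ j j′ → cong (_* V C j′) (trans (hockeyStick U j) (cong (_C suc j) (sym (+-suc U j))))) ⟩
    wordSum a (λ j j′ → (U + suc j) C suc j * V C j′) ∎

  -- A negative entry consumes at least one unit, so a bound V + 1 leaves any v between 0 and V.
  -- Summing raises j′ by one, as if a letter y were added to the word.
  negativeHeads : ∀ a U V →
    antiSum V (λ _ v → signedCount a U v) ≡ wordSum a (λ j j′ → (U + j) C j * suc V C suc j′)
  negativeHeads a U V = begin
    antiSum V (λ _ v → signedCount a U v)
      ≡⟨ wordSum-anti a V (λ j j′ _ v → (U + j) C j * v C j′) ⟨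
    wordSum a (λ j j′ → antiSum V (λ _ v → (U + j) C j * v C j′))
      ≡⟨ wordSum-cong′ a (λ j j′ → anti-*ˡ V ((U + j) C j) (λ _ v → v C j′)) ⟨
    wordSum a (λ j j′ → (U + j) C j * antiSum V (λ _ v → v C j′))
      ≡⟨ wordSum-cong′ a (λ j j′ → cong ((U + j) C j *_) (trans
           (anti-cong V (λ u v _ → sym (+-identityʳ (v C j′)))) (upperConvolution V 0 j′))) ⟩
    wordSum a (λ j j′ → (U + j) C j * suc V C suc j′) ∎

  -- The summand 0 is the number of vectors with negative head when V = 0; on the other side
  -- `0 C suc j′` vanishes.
  signedCount-suc-zero : ∀ a U → antiSum U (λ _ u → signedCount a u 0) + 0 ≡ signedCount (suc a) U 0
  signedCount-suc-zero a U = begin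
    antiSum U (λ _ u → signedCount a u 0) + 0
      ≡⟨ +-identityʳ _ ⟩
    antiSum U (λ _ u → signedCount a u 0)
      ≡⟨ nonnegativeHeads a U 0 ⟩
    wordSum a (λ j j′ → (U + suc j) C suc j * 0 C j′)
      ≡⟨ wordSum-cong′ a (λ j j′ → trans (sym (+-identityʳ _))
           (cong ((U + suc j) C suc j * 0 C j′ +_) (sym (*-zeroʳ ((U + j) C j))))) ⟩
    signedCount (suc a) U 0 ∎

  signedCount-suc-suc : ∀ a U V →
    antiSum U (λ _ u → signedCount a u (suc V)) + antiSum V (λ _ v → signedCount a U v) ≡ signedCount (suc a) U (suc V)
  signedCount-suc-suc a U V = trans (cong₂ _+_ (nonnegativeHeads a U (suc V)) (negativeHeads a U V)) (wordSum-+ a _ _)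

  pairCount : ℕ → ℕ → ℕ → ℕ
  pairCount a b n = antiSum n (λ U V → signedCount a U V * signedCount b V U)

  -- The coefficient of tⁿ in tʳ/(1-t)^{d+1} when r ≤ d.
  shiftedSeries : ℕ → ℕ → ℕ → ℕ
  shiftedSeries d n r = (n + d ∸ r) C d

  pairCount-wordSum : ∀ a b n → pairCount a b n ≡
    wordSum a (λ j j′ → wordSum b (λ k k′ →
      (j + k′) C j * (k + j′) C k * shiftedSeries (dim a b) n (j′ + k′)))
  pairCount-wordSum a b n = begin
    antiSum n (λ U V → signedCount a U V * signedCount b V U)
      ≡⟨ anti-cong n (λ U V _ → trans
           (wordSum-*ʳ a (signedCount b V U) (λ j j′ → (U + j) C j * V C j′))
           (wordSum-cong′ a (λ j j′ → wordSum-*ˡ b ((U + j) C j * V C j′) (λ k k′ → (V + k) C k * U C k′)))) ⟩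
    antiSum n (λ U V → wordSum a (λ j j′ → wordSum b (λ k k′ → summand j j′ k k′ U V)))
      ≡⟨ wordSum-anti a n (λ j j′ U V → wordSum b (λ k k′ → summand j j′ k k′ U V)) ⟨
    wordSum a (λ j j′ → antiSum n (λ U V → wordSum b (λ k k′ → summand j j′ k k′ U V)))
      ≡⟨ wordSum-cong′ a (λ j j′ → wordSum-anti b n (summand j j′)) ⟨
    wordSum a (λ j j′ → wordSum b (λ k k′ → antiSum n (summand j j′ k k′)))
      ≡⟨ wordSum-cong a (λ j j′ p → wordSum-cong b (λ k k′ q → convolve j j′ k k′ p q)) ⟩
    wordSum a (λ j j′ → wordSum b (λ k k′ →
      (j + k′) C j * (k + j′) C k * shiftedSeries (dim a b) n (j′ + k′))) ∎
    where
    summand : ℕ → ℕ → ℕ → ℕ → ℕ → ℕ → ℕ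
    summand j j′ k k′ U V = (U + j) C j * V C j′ * ((V + k) C k * U C k′)

    convolve : ∀ j j′ k k′ → j + j′ ≡ a → k + k′ ≡ b →
      antiSum n (summand j j′ k k′) ≡ (j + k′) C j * (k + j′) C k * shiftedSeries (dim a b) n (j′ + k′)
    convolve j j′ k k′ refl refl = begin
      antiSum n (summand j j′ k k′)
        ≡⟨ anti-cong n (λ U V _ → revise U V) ⟩
      antiSum n (λ U V → (j + k′) C j * (k + j′) C k * ((U + j) C (j + k′) * (V + k) C (k + j′)))
        ≡⟨ anti-*ˡ n ((j + k′) C j * (k + j′) C k) _ ⟨
      (j + k′) C j * (k + j′) C k * antiSum n (λ U V → (U + j) C (j + k′) * (V + k) C (k + j′))
        ≡⟨ cong ((j + k′) C j * (k + j′) C k *_) (shiftedConvolution n j k k′ j′) ⟩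
      (j + k′) C j * (k + j′) C k * suc (n + j + k) C suc (j + k′ + (k + j′))
        -- With d = j + j′ + k + k′ + 1 the upper index is n + d - (j′ + k′) and the lower one is d:
        -- the coefficient of t^n in t^(j′+k′) / (1-t)^(d+1).
        ≡⟨ cong₂ (λ m l → (j + k′) C j * (k + j′) C k * m C l) upper (lower j j′ k k′) ⟩
      (j + k′) C j * (k + j′) C k * shiftedSeries (dim (j + j′) (k + k′)) n (j′ + k′) ∎
      where
      revise : ∀ U V → summand j j′ k k′ U V ≡
        (j + k′) C j * (k + j′) C k * ((U + j) C (j + k′) * (V + k) C (k + j′))
      -- The two binomials in U are brought together, and likewise the two in V; each pair leaves a
      -- constant and a single binomial, ready for the convolution.
      revise U V = begin
        (U + j) C j * V C j′ * ((V + k) C k * U C k′)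
          ≡⟨ pairUp ((U + j) C j) (V C j′) ((V + k) C k) (U C k′) ⟩
        (U + j) C j * U C k′ * ((V + k) C k * V C j′)
          ≡⟨ cong₂ _*_ (trinomialRevision U j k′) (trinomialRevision V k j′) ⟩
        (U + j) C (j + k′) * (j + k′) C j * ((V + k) C (k + j′) * (k + j′) C k)
          ≡⟨ reorder ((U + j) C (j + k′)) ((j + k′) C j) ((V + k) C (k + j′)) ((k + j′) C k) ⟩
        (j + k′) C j * (k + j′) C k * ((U + j) C (j + k′) * (V + k) C (k + j′)) ∎
        where
        pairUp : ∀ x y z w → x * y * (z * w) ≡ x * w * (z * y)
        pairUp = solve-∀
        reorder : ∀ x y z w → x * y * (z * w) ≡ y * w * (x * z)
        reorder = solve-∀
      lower : ∀ j j′ k k′ → suc (j + k′ + (k + j′)) ≡ j + j′ + (k + k′) + 1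
      lower = solve-∀
      total : ∀ n j j′ k k′ → n + (j + j′ + (k + k′) + 1) ≡ j′ + k′ + suc (n + j + k)
      total = solve-∀
      upper : suc (n + j + k) ≡ n + dim (j + j′) (k + k′) ∸ (j′ + k′)
      upper = sym (trans (cong (_∸ (j′ + k′)) (total n j j′ k k′)) (m+n∸m≡n (j′ + k′) (suc (n + j + k))))

  -- Series with numerator t^i (1+t)^e

  coeffMono-suc : ∀ i e m → coeffMono i (suc e) m ≡ coeffMono i e m + coeffMono (suc i) e m
  coeffMono-suc i e m with i ≤? m | suc i ≤? m
  ... | yes i≤m | yes i<m = begin
    suc e C (m ∸ i)                    ≡⟨ cong (suc e C_) m∸i≡ ⟩
    suc e C suc (m ∸ suc i)            ≡⟨ pascal e (m ∸ suc i) ⟩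
    e C (m ∸ suc i) + e C suc (m ∸ suc i) ≡⟨ +-comm (e C (m ∸ suc i)) _ ⟩
    e C suc (m ∸ suc i) + e C (m ∸ suc i) ≡⟨ cong (λ l → e C l + e C (m ∸ suc i)) m∸i≡ ⟨
    e C (m ∸ i) + e C (m ∸ suc i)      ∎
    where
    m∸i≡ : m ∸ i ≡ suc (m ∸ suc i)
    m∸i≡ = +-∸-assoc 1 i<m
  -- Here m = i: both constant coefficients `suc e C 0` and `e C 0` are 1, and the shifted monomial
  -- contributes 0.
  ... | yes i≤m | no  i≮m rewrite m≤n⇒m∸n≡0 {m} {i} (≮⇒≥ i≮m) = refl
  ... | no  i≰m | yes i<m = contradiction (<⇒≤ i<m) i≰m
  ... | no  i≰m | no  i≮m = refl

  coeffMono-zero-self : ∀ i → coeffMono i 0 i ≡ 1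
  coeffMono-zero-self i with i ≤? i
  ... | yes _   rewrite n∸n≡0 i = refl
  ... | no  i≰i = contradiction ≤-refl i≰i

  coeffMono-zero-other : ∀ i m → i ≢ m → coeffMono i 0 m ≡ 0
  coeffMono-zero-other i m i≢m with i ≤? m
  ... | yes i≤m = k>n⇒nCk≡0 (m<n⇒0<n∸m (≤∧≢⇒< i≤m i≢m))
  ... | no  _   = refl

  sum-single : ∀ {n} i (f : ℕ → ℕ) → i ≤ n → (∀ m → i ≢ m → f m ≡ 0) → sumℕ≤ n f ≡ f i
  sum-single {n} i f i≤n vanish = trans (sum-truncate f i≤n (λ m i<m → vanish m (<⇒≢ i<m))) (last i vanish)
    where
    last : ∀ i → (∀ m → i ≢ m → f m ≡ 0) → sumℕ≤ i f ≡ f i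
    last zero    vanish = refl
    last (suc i) vanish = cong (_+ f (suc i)) (trans
      (sum-cong i (λ m m≤i → vanish m (>⇒≢ (s≤s m≤i)))) (sum-zero i (λ _ → refl)))

  -- The exponent of the denominator comes from a positive degree: truncated subtraction can bring
  -- the upper index down to 0, and `0 C 0` would be 1.
  shiftedSeries-vanish : ∀ d n r → n < r → shiftedSeries (suc d) n r ≡ 0
  shiftedSeries-vanish d n (suc r) (s≤s n≤r) = k>n⇒nCk≡0 {n + suc d ∸ suc r} {suc d}
    (subst (λ m → m ∸ suc r < suc d) (sym (+-suc n d))
      (s≤s (≤-trans (∸-monoʳ-≤ (n + d) n≤r) (≤-reflexive (m+n∸m≡n n d)))))

  -- Division by a power of 1 - t is linear in the numerator, and t^i (1+t)^(e+1) = t^i (1+t)^e +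
  -- t^(i+1) (1+t)^e is exactly the recursion of `wordSum`.
  ehrhartFromH-mono : ∀ d i e n → ehrhartFromH (suc d) (coeffMono i e) n ≡
    wordSum e (λ _ l → shiftedSeries (suc d) n (i + l))
  ehrhartFromH-mono d i zero    n with i ≤? n
  ... | yes i≤n = begin
    ehrhartFromH (suc d) (coeffMono i 0) n
      ≡⟨ sum-single i _ i≤n (λ m i≢m → cong (_* (n ∸ m + suc d) C suc d) (coeffMono-zero-other i m i≢m)) ⟩
    coeffMono i 0 i * (n ∸ i + suc d) C suc d
      ≡⟨ trans (cong (_* (n ∸ i + suc d) C suc d) (coeffMono-zero-self i)) (+-identityʳ _) ⟩
    (n ∸ i + suc d) C suc d
      ≡⟨ cong (_C suc d) (sym (+-∸-comm (suc d) i≤n)) ⟩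
    shiftedSeries (suc d) n i
      ≡⟨ cong (shiftedSeries (suc d) n) (+-identityʳ i) ⟨
    shiftedSeries (suc d) n (i + 0) ∎
  ... | no  i≰n = begin
    ehrhartFromH (suc d) (coeffMono i 0) n
      ≡⟨ sum-cong n (λ m m≤n → cong (_* (n ∸ m + suc d) C suc d)
           (coeffMono-zero-other i m (λ i≡m → i≰n (subst (_≤ n) (sym i≡m) m≤n)))) ⟩
    sumℕ≤ n (λ _ → 0)
      ≡⟨ sum-zero n (λ _ → refl) ⟩
    0
      ≡⟨ shiftedSeries-vanish d n (i + 0) (≤-trans (≰⇒> i≰n) (m≤m+n i 0)) ⟨
    shiftedSeries (suc d) n (i + 0) ∎
  ehrhartFromH-mono d i (suc e) n = begin
    ehrhartFromH (suc d) (coeffMono i (suc e)) n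
      ≡⟨ sum-cong n (λ m _ → trans (cong (_* (n ∸ m + suc d) C suc d) (coeffMono-suc i e m))
           (*-distribʳ-+ ((n ∸ m + suc d) C suc d) (coeffMono i e m) (coeffMono (suc i) e m))) ⟩
    sumℕ≤ n (λ m → coeffMono i e m * (n ∸ m + suc d) C suc d + coeffMono (suc i) e m * (n ∸ m + suc d) C suc d)
      ≡⟨ sum-+ n _ _ ⟨
    ehrhartFromH (suc d) (coeffMono i e) n + ehrhartFromH (suc d) (coeffMono (suc i) e) n
      ≡⟨ cong₂ _+_ (ehrhartFromH-mono d i e n) (ehrhartFromH-mono d (suc i) e n) ⟩
    wordSum e (λ _ l → shiftedSeries (suc d) n (i + l)) + wordSum e (λ _ l → shiftedSeries (suc d) n (suc i + l))
      ≡⟨ wordSum-+ e _ _ ⟩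
    wordSum e (λ _ l → shiftedSeries (suc d) n (i + l) + shiftedSeries (suc d) n (suc i + l))
      ≡⟨ wordSum-cong′ e (λ _ l → cong (λ s → shiftedSeries (suc d) n (i + l) + shiftedSeries (suc d) n s) (sym (+-suc i l))) ⟩
    wordSum (suc e) (λ _ l → shiftedSeries (suc d) n (i + l)) ∎

  m≤a⊓b⇒2m≤a+b : ∀ {a b m} → m ≤ a ⊓ b → 2 * m ≤ a + b
  m≤a⊓b⇒2m≤a+b {a} {b} {m} m≤ = +-mono-≤ (≤-trans m≤ (m⊓n≤m a b))
    (≤-trans (≤-reflexive (+-identityʳ m)) (≤-trans m≤ (m⊓n≤n a b)))

  ehrhart-wordSum : ∀ a b n → ehrhartFromH (dim a b) (rhsCoeff a b) n ≡
    sumℕ≤ (a ⊓ b) (λ i → γ-coefficient a b i * wordSum (dim a b ∸ 2 * i) (λ _ l → shiftedSeries (dim a b) n (i + l)))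
  ehrhart-wordSum a b n = begin
    sumℕ≤ n (λ m → rhsCoeff a b m * X m)
      ≡⟨ sum-cong n (λ m _ → sum-*ʳ (a ⊓ b) (X m) (λ i → γ-coefficient a b i * coeffMono i (D ∸ 2 * i) m)) ⟩
    sumℕ≤ n (λ m → sumℕ≤ (a ⊓ b) (λ i → γ-coefficient a b i * coeffMono i (D ∸ 2 * i) m * X m))
      ≡⟨ sum-exchange {Λ = sumℕ≤ (a ⊓ b)} (sum-+ (a ⊓ b)) n (λ m i → γ-coefficient a b i * coeffMono i (D ∸ 2 * i) m * X m) ⟩
    sumℕ≤ (a ⊓ b) (λ i → sumℕ≤ n (λ m → γ-coefficient a b i * coeffMono i (D ∸ 2 * i) m * X m))
      ≡⟨ sum-cong (a ⊓ b) (λ i _ → trans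
           (sum-cong n (λ m _ → *-assoc (γ-coefficient a b i) (coeffMono i (D ∸ 2 * i) m) (X m)))
           (sym (sum-*ˡ n (γ-coefficient a b i) (λ m → coeffMono i (D ∸ 2 * i) m * X m)))) ⟩
    sumℕ≤ (a ⊓ b) (λ i → γ-coefficient a b i * ehrhartFromH D (coeffMono i (D ∸ 2 * i)) n)
      ≡⟨ sum-cong (a ⊓ b) (λ i _ → cong (γ-coefficient a b i *_) (mono i (D ∸ 2 * i))) ⟩
    sumℕ≤ (a ⊓ b) (λ i → γ-coefficient a b i * wordSum (D ∸ 2 * i) (λ _ l → shiftedSeries D n (i + l))) ∎
    where
    D = dim a b
    X : ℕ → ℕ
    X m = (n ∸ m + D) C D
    mono : ∀ i e → ehrhartFromH D (coeffMono i e) n ≡ wordSum e (λ _ l → shiftedSeries D n (i + l))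
    mono i e = subst (λ d → ehrhartFromH d (coeffMono i e) n ≡ wordSum e (λ _ l → shiftedSeries d n (i + l)))
      (+-comm 1 (a + b)) (ehrhartFromH-mono (a + b) i e n)

  -- S(n) + S(n-1) as an Ehrhart series, and γ-positivity

  pairCountPred : ℕ → ℕ → ℕ → ℕ
  pairCountPred a b zero    = 0
  pairCountPred a b (suc n) = pairCount a b n

  pairCount-expansion : ∀ a b n → pairCount a b n ≡
    sumℕ≤ (a ⊓ b) (λ i → γ-coefficient a b i * wordSum (a + b ∸ 2 * i) (λ _ l → shiftedSeries (dim a b) n (i + l)))
  pairCount-expansion a b n = trans (pairCount-wordSum a b n) (γ-expansion a b (shiftedSeries (dim a b) n))

  pairCountPred-expansion : ∀ a b n → pairCountPred a b n ≡
    sumℕ≤ (a ⊓ b) (λ i → γ-coefficient a b i * wordSum (a + b ∸ 2 * i) (λ _ l → shiftedSeries (dim a b) n (suc (i + l))))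
  pairCountPred-expansion a b zero    = sym (trans
    (sum-cong (a ⊓ b) (λ i _ → trans (cong (γ-coefficient a b i *_) (wordSum-zero (a + b ∸ 2 * i) i)) (*-zeroʳ (γ-coefficient a b i))))
    (sum-zero (a ⊓ b) (λ _ → refl)))
    where
    wordSum-zero : ∀ e i → wordSum e (λ _ l → shiftedSeries (dim a b) 0 (suc (i + l))) ≡ 0
    wordSum-zero e i = trans
      (wordSum-cong′ e (λ _ l → subst (λ d → shiftedSeries d 0 (suc (i + l)) ≡ 0) (+-comm 1 (a + b))
        (shiftedSeries-vanish (a + b) 0 (suc (i + l)) z<s)))
      (sym (wordSum-*ˡ e 0 (λ _ _ → 0)))
  -- `suc n + d ∸ suc r` computes to `n + d ∸ r`, so the additional factor t is absorbed
  -- definitionally.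
  pairCountPred-expansion a b (suc n) = pairCount-expansion a b n

  pairCount-ehrhart : ∀ a b n → pairCount a b n + pairCountPred a b n ≡ ehrhartFromH (dim a b) (rhsCoeff a b) n
  pairCount-ehrhart a b n = begin
    pairCount a b n + pairCountPred a b n
      ≡⟨ cong₂ _+_ (pairCount-expansion a b n) (pairCountPred-expansion a b n) ⟩
    sumℕ≤ (a ⊓ b) (λ i → γ-coefficient a b i * wordSum (e i) (λ _ l → T (i + l))) +
    sumℕ≤ (a ⊓ b) (λ i → γ-coefficient a b i * wordSum (e i) (λ _ l → T (suc (i + l))))
      ≡⟨ sum-+ (a ⊓ b) _ _ ⟩
    sumℕ≤ (a ⊓ b) (λ i → γ-coefficient a b i * wordSum (e i) (λ _ l → T (i + l)) +
                         γ-coefficient a b i * wordSum (e i) (λ _ l → T (suc (i + l))))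
      ≡⟨ sum-cong (a ⊓ b) combine ⟩
    sumℕ≤ (a ⊓ b) (λ i → γ-coefficient a b i * wordSum (dim a b ∸ 2 * i) (λ _ l → T (i + l)))
      ≡⟨ ehrhart-wordSum a b n ⟨
    ehrhartFromH (dim a b) (rhsCoeff a b) n ∎
    where
    T = shiftedSeries (dim a b) n
    e : ℕ → ℕ
    e i = a + b ∸ 2 * i
    combine : ∀ i → i ≤ a ⊓ b →
      γ-coefficient a b i * wordSum (e i) (λ _ l → T (i + l)) + γ-coefficient a b i * wordSum (e i) (λ _ l → T (suc (i + l))) ≡
      γ-coefficient a b i * wordSum (dim a b ∸ 2 * i) (λ _ l → T (i + l))
    combine i i≤ = begin
      g * wordSum (e i) (λ _ l → T (i + l)) + g * wordSum (e i) (λ _ l → T (suc (i + l)))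
        ≡⟨ *-distribˡ-+ g _ _ ⟨
      g * (wordSum (e i) (λ _ l → T (i + l)) + wordSum (e i) (λ _ l → T (suc (i + l))))
        ≡⟨ cong (g *_) (wordSum-+ (e i) _ _) ⟩
      g * wordSum (e i) (λ _ l → T (i + l) + T (suc (i + l)))
        ≡⟨ cong (g *_) (wordSum-cong′ (e i) (λ _ l → cong (λ s → T (i + l) + T s) (sym (+-suc i l)))) ⟩
      -- Adding the series shifted by one is multiplication by 1 + t, which is one further letter in
      -- the word. That `suc (e i)` is the exponent `dim a b ∸ 2 * i` rests on 2i ≤ a + b.
      g * wordSum (suc (e i)) (λ _ l → T (i + l))
        ≡⟨ cong (λ m → g * wordSum m (λ _ l → T (i + l)))
             (trans (sym (+-∸-assoc 1 (m≤a⊓b⇒2m≤a+b i≤))) (cong (_∸ 2 * i) (+-comm 1 (a + b)))) ⟩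
      g * wordSum (dim a b ∸ 2 * i) (λ _ l → T (i + l)) ∎
      where g = γ-coefficient a b i

  -- The two ranges of summation differ, but min(a, b) ≤ ⌊d/2⌋, and a coefficient with index beyond
  -- min(a, b) contains a zero binomial.
  γ-positive : ∀ a b → GammaPositive (dim a b) (rhsCoeff a b)
  γ-positive a b = γ-coefficient a b , λ k → sym (sum-truncate _ bound (λ i M<i → cong (_* coeffMono i (dim a b ∸ 2 * i) k) (vanish i M<i)))
    where
    bound : a ⊓ b ≤ dim a b / 2
    bound = ≤-trans (≤-reflexive (sym (m*n/n≡m (a ⊓ b) 2)))
      (/-monoˡ-≤ 2 (≤-trans (≤-reflexive (*-comm (a ⊓ b) 2)) (≤-trans (m≤a⊓b⇒2m≤a+b {a} {b} ≤-refl) (m≤m+n (a + b) 1))))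
    vanish : ∀ i → a ⊓ b < i → γ-coefficient a b i ≡ 0
    vanish i M<i with a <? i
    ... | yes a<i = cong (_* b C i) (trans (cong ((2 * i) C i *_) (k>n⇒nCk≡0 a<i)) (*-zeroʳ ((2 * i) C i)))
    ... | no  a≮i = trans (cong ((2 * i) C i * a C i *_) (k>n⇒nCk≡0 (≰⇒> λ i≤b → <⇒≱ M<i (⊓-glb (≮⇒≥ a≮i) i≤b)))) (*-zeroʳ ((2 * i) C i * a C i))

module Enumeration where

  open BinomialSums
  open import Data.Empty using (⊥)
  open import Data.Integer using (ℤ; +_; -[1+_]; _⊖_)
  open import Data.Integer.Properties using ([1+m]⊖[1+n]≡m⊖n)
  open import Data.List using (List; []; _∷_; _++_; map; length; cartesianProductWith)
  open import Data.List.Membership.Propositional using (_∈_)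
  open import Data.List.Membership.Propositional.Properties
    using (∈-map⁺; ∈-map⁻; ∈-++⁺ˡ; ∈-++⁺ʳ; ∈-++⁻; ∈-cartesianProductWith⁺; ∈-cartesianProductWith⁻)
  open import Data.List.Properties using (length-++; length-map)
  open import Data.List.Relation.Unary.All using ([])
  open import Data.List.Relation.Unary.AllPairs using ([]; _∷_)
  open import Data.List.Relation.Unary.Any using (here)
  open import Data.List.Relation.Unary.Unique.Propositional using (Unique)
  open import Data.List.Relation.Unary.Unique.Propositional.Properties using (map⁺; ++⁺; cartesianProductWith⁺)
  open import Data.Nat
  open import Data.Nat.Properties
  open import Data.Nat.Tactic.RingSolver using (solve-∀)
  open import Data.Product using (∃; ∃₂; Σ-syntax)
  open import Data.Sum using (_⊎_; inj₁; inj₂)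
  open import Data.Vec as Vec using (Vec; []; _∷_)
  open import Data.Vec.Properties as Vec using (∷-injectiveʳ)
  open import Function.Bundles using (_⇔_)
  open import Relation.Nullary using (contradiction)
  open ≡-Reasoning

  -- Duplicate-free lists indexed by antidiagonals

  length-cartesianProductWith : ∀ {A B C : Set} (f : A → B → C) xs ys →
    length (cartesianProductWith f xs ys) ≡ length xs * length ys
  length-cartesianProductWith f []       ys = refl
  length-cartesianProductWith f (x ∷ xs) ys = trans (length-++ (map (f x) ys))
    (cong₂ _+_ (length-map (f x) ys) (length-cartesianProductWith f xs ys))

  antiList : ∀ {X : Set} → ℕ → (ℕ → ℕ → List X) → List X
  antiList zero    f = f 0 0
  antiList (suc n) f = f 0 (suc n) ++ antiList n (λ u v → f (suc u) v)

  length-antiList : ∀ {X : Set} n (f : ℕ → ℕ → List X) → length (antiList n f) ≡ antiSum n (λ u v → length (f u v))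
  length-antiList zero    f = refl
  length-antiList (suc n) f = trans (length-++ (f 0 (suc n))) (cong (λ l → length (f 0 (suc n)) + l) (length-antiList n _))

  ∈-antiList⁺ : ∀ {X : Set} {x} u v (f : ℕ → ℕ → List X) → x ∈ f u v → x ∈ antiList (u + v) f
  ∈-antiList⁺ zero    zero    f x∈ = x∈
  ∈-antiList⁺ zero    (suc v) f x∈ = ∈-++⁺ˡ x∈
  ∈-antiList⁺ (suc u) v       f x∈ = ∈-++⁺ʳ (f 0 (suc (u + v))) (∈-antiList⁺ u v (λ u v → f (suc u) v) x∈)

  ∈-antiList⁻ : ∀ {X : Set} {x} n (f : ℕ → ℕ → List X) → x ∈ antiList n f → ∃₂ λ u v → u + v ≡ n × x ∈ f u v
  ∈-antiList⁻ zero    f x∈ = 0 , 0 , refl , x∈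
  ∈-antiList⁻ (suc n) f x∈ with ∈-++⁻ (f 0 (suc n)) x∈
  ... | inj₁ x∈ˡ = 0 , suc n , refl , x∈ˡ
  ... | inj₂ x∈ʳ with u , v , p , x∈f ← ∈-antiList⁻ n (λ u v → f (suc u) v) x∈ʳ = suc u , v , cong suc p , x∈f

  antiList-unique : ∀ {X : Set} n (f : ℕ → ℕ → List X) →
    (∀ u v → u + v ≡ n → Unique (f u v)) →
    (∀ {x} u v u′ v′ → u + v ≡ n → u′ + v′ ≡ n → x ∈ f u v → x ∈ f u′ v′ → u ≡ u′) →
    Unique (antiList n f)
  antiList-unique zero    f uniq disj = uniq 0 0 refl
  antiList-unique (suc n) f uniq disj = ++⁺ (uniq 0 (suc n) refl)
    (antiList-unique n _ (λ u v p → uniq (suc u) v (cong suc p))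
      (λ u v u′ v′ p p′ x∈ x∈′ → suc-injective (disj (suc u) v (suc u′) v′ (cong suc p) (cong suc p′) x∈ x∈′)))
    λ (x∈ˡ , x∈ʳ) → let (u , v , p , x∈) = ∈-antiList⁻ n _ x∈ʳ in
      contradiction (disj 0 (suc n) (suc u) v refl (cong suc p) x∈ˡ x∈) 0≢1+n

  -- Vectors that fit a pair of bounds

  posPart negPart : ℤ → ℕ
  posPart (+ n)    = n
  posPart -[1+ n ] = 0
  negPart (+ n)    = 0
  negPart -[1+ n ] = suc n

  partSum : ∀ {m} → (ℤ → ℕ) → Vec ℤ m → ℕ
  partSum f []      = 0
  partSum f (x ∷ p) = f x + partSum f p

  posSum negSum : ∀ {m} → Vec ℤ m → ℕ
  posSum = partSum posPart
  negSum = partSum negPart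

  Fits : ∀ {m} → ℕ → ℕ → Vec ℤ m → Set
  Fits U V p = ∃ λ c → posSum p + c ≡ U × negSum p + c ≡ V

  -- In one coordinate exactly one integer fits, namely U - V, with slack min(U, V): each common
  -- successor of U and V adds one to the slack and leaves the difference alone.
  Fits-⊖ : ∀ U V → Fits U V (U ⊖ V ∷ [])
  Fits-⊖ zero    zero    = 0 , refl , refl
  Fits-⊖ zero    (suc V) = 0 , refl , cong suc (trans (+-identityʳ (V + 0)) (+-identityʳ V))
  Fits-⊖ (suc U) zero    = 0 , cong suc (trans (+-identityʳ (U + 0)) (+-identityʳ U)) , refl
  Fits-⊖ (suc U) (suc V) rewrite [1+m]⊖[1+n]≡m⊖n U V with c , p , q ← Fits-⊖ U V =
    suc c , trans (+-suc _ c) (cong suc p) , trans (+-suc _ c) (cong suc q)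

  ⊖-unique : ∀ x c → x ≡ (posPart x + c) ⊖ (negPart x + c)
  ⊖-unique (+ n)    zero    = sym (cong (_⊖ 0) (+-identityʳ n))
  ⊖-unique -[1+ n ] zero    = sym (cong (0 ⊖_) (+-identityʳ (suc n)))
  ⊖-unique x        (suc c) = trans (⊖-unique x c) (sym (trans
    (cong₂ _⊖_ (+-suc (posPart x) c) (+-suc (negPart x) c)) ([1+m]⊖[1+n]≡m⊖n (posPart x + c) (negPart x + c))))

  -- The antidiagonal of n - 1, empty for n = 0. It serves both for negative heads, which use at
  -- least one unit of V, and for the layer U + V = n - 1.
  predList : ∀ {X : Set} → ℕ → (ℕ → ℕ → List X) → List X
  predList zero    f = []
  predList (suc n) f = antiList n f

  -- The head `+ x` takes x from U and the head `-[1+ y ]` takes 1 + y from V; the slack is passed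
  -- on unchanged and is settled by the last coordinate.
  fitting : ∀ a → ℕ → ℕ → List (Vec ℤ (suc a))
  fitting zero    U V = (U ⊖ V ∷ []) ∷ []
  fitting (suc a) U V = antiList U (λ x u → map (+ x ∷_) (fitting a u V)) ++
                        predList V (λ y v → map (-[1+ y ] ∷_) (fitting a U v))

  length-fitting : ∀ a U V → length (fitting a U V) ≡ signedCount a U V
  length-fitting zero    U V = refl
  length-fitting (suc a) U V = trans (length-++ (antiList U (λ x u → map (+ x ∷_) (fitting a u V)))) (trans
    (cong (_+ length (predList V (λ y v → map (-[1+ y ] ∷_) (fitting a U v)))) nonneg) (total V))
    where
    nonneg : length (antiList U (λ x u → map (+ x ∷_) (fitting a u V))) ≡ antiSum U (λ _ u → signedCount a u V)
    nonneg = trans (length-antiList U _)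
      (anti-cong U (λ x u _ → trans (length-map (+ x ∷_) (fitting a u V)) (length-fitting a u V)))
    total : ∀ V → antiSum U (λ _ u → signedCount a u V) +
                  length (predList V (λ y v → map (-[1+ y ] ∷_) (fitting a U v))) ≡ signedCount (suc a) U V
    total zero    = signedCount-suc-zero a U
    total (suc V) = trans
      (cong (λ l → antiSum U (λ _ u → signedCount a u (suc V)) + l) (trans (length-antiList V _)
        (anti-cong V (λ y v _ → trans (length-map (-[1+ y ] ∷_) (fitting a U v)) (length-fitting a U v)))))
      (signedCount-suc-suc a U V)

  ∈-fitting⁺ : ∀ a {U V} (p : Vec ℤ (suc a)) → Fits U V p → p ∈ fitting a U V
  ∈-fitting⁺ zero    (x ∷ [])        (c , refl , refl) = here (cong (_∷ []) (trans (⊖-unique x c)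
    (cong₂ (λ u v → (u + c) ⊖ (v + c)) (sym (+-identityʳ (posPart x))) (sym (+-identityʳ (negPart x))))))
  ∈-fitting⁺ (suc a) {V = V} (+ n ∷ p)    (c , refl , q) = ∈-++⁺ˡ
    (subst (λ U → (+ n ∷ p) ∈ antiList U (λ x u → map (+ x ∷_) (fitting a u V))) (sym (+-assoc n (posSum p) c))
      (∈-antiList⁺ n (posSum p + c) _ (∈-map⁺ (+ n ∷_) (∈-fitting⁺ a p (c , refl , q)))))
  ∈-fitting⁺ (suc a) {U} (-[1+ n ] ∷ p) (c , q , refl) = ∈-++⁺ʳ
    (antiList U (λ x u → map (+ x ∷_) (fitting a u (suc n + negSum p + c))))
    (subst (λ V → (-[1+ n ] ∷ p) ∈ antiList V (λ y v → map (-[1+ y ] ∷_) (fitting a U v))) (sym (+-assoc n (negSum p) c))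
      (∈-antiList⁺ n (negSum p + c) _ (∈-map⁺ (-[1+ n ] ∷_) (∈-fitting⁺ a p (c , q , refl)))))

  ∈-predList⁻ : ∀ {X : Set} {x} n (f : ℕ → ℕ → List X) → x ∈ predList n f → ∃₂ λ u v → suc (u + v) ≡ n × x ∈ f u v
  ∈-predList⁻ (suc n) f x∈ with u , v , p , x∈f ← ∈-antiList⁻ n f x∈ = u , v , cong suc p , x∈f

  ∈-fitting⁻ : ∀ a {U V} (p : Vec ℤ (suc a)) → p ∈ fitting a U V → Fits U V p
  ∈-fitting⁻ zero    {U} {V} p (here refl) = Fits-⊖ U V
  ∈-fitting⁻ (suc a) {U} {V} p p∈ with ∈-++⁻ (antiList U _) p∈
  ... | inj₁ p∈ˡ with n , u , refl , p∈map ← ∈-antiList⁻ U _ p∈ˡ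
                 with p′ , p′∈ , refl ← ∈-map⁻ (+ n ∷_) p∈map
                 with c , refl , q ← ∈-fitting⁻ a p′ p′∈ = c , +-assoc n (posSum p′) c , q
  ... | inj₂ p∈ʳ with n , v , refl , p∈map ← ∈-predList⁻ V _ p∈ʳ
                 with p′ , p′∈ , refl ← ∈-map⁻ (-[1+ n ] ∷_) p∈map
                 with c , q , refl ← ∈-fitting⁻ a p′ p′∈ = c , q , cong suc (+-assoc n (negSum p′) c)

  fitting-unique : ∀ a U V → Unique (fitting a U V)
  fitting-unique zero    U V = [] ∷ []
  fitting-unique (suc a) U V = ++⁺
    (antiList-unique U _ (λ x u _ → map⁺ ∷-injectiveʳ (fitting-unique a u V)) sameHead⁺)
    (negatives V)
    λ (p∈ˡ , p∈ʳ) → separate (∈-antiList⁻ U _ p∈ˡ) (∈-predList⁻ V _ p∈ʳ)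
    where
    sameHead⁺ : ∀ {p} x u x′ u′ → x + u ≡ U → x′ + u′ ≡ U →
      p ∈ map (+ x ∷_) (fitting a u V) → p ∈ map (+ x′ ∷_) (fitting a u′ V) → x ≡ x′
    sameHead⁺ x u x′ u′ _ _ p∈ p∈′
      with _ , _ , refl ← ∈-map⁻ (+ x ∷_) p∈ with _ , _ , refl ← ∈-map⁻ (+ x′ ∷_) p∈′ = refl
    sameHead⁻ : ∀ {p} y v y′ v′ → p ∈ map (-[1+ y ] ∷_) (fitting a U v) → p ∈ map (-[1+ y′ ] ∷_) (fitting a U v′) → y ≡ y′
    sameHead⁻ y v y′ v′ p∈ p∈′
      with _ , _ , refl ← ∈-map⁻ (-[1+ y ] ∷_) p∈ with _ , _ , refl ← ∈-map⁻ (-[1+ y′ ] ∷_) p∈′ = refl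
    negatives : ∀ V → Unique (predList V (λ y v → map (-[1+ y ] ∷_) (fitting a U v)))
    negatives zero    = []
    negatives (suc V) = antiList-unique V _ (λ y v _ → map⁺ ∷-injectiveʳ (fitting-unique a U v))
      (λ y v y′ v′ _ _ → sameHead⁻ y v y′ v′)
    separate : ∀ {p} → (∃₂ λ x u → x + u ≡ U × p ∈ map (+ x ∷_) (fitting a u V)) →
      (∃₂ λ y v → suc (y + v) ≡ V × p ∈ map (-[1+ y ] ∷_) (fitting a U v)) → ⊥
    separate (x , _ , _ , p∈) (y , _ , _ , p∈′)
      with _ , _ , refl ← ∈-map⁻ (+ x ∷_) p∈ with _ , _ , () ← ∈-map⁻ (-[1+ y ] ∷_) p∈′

  -- The lattice points in two layers

  FitsPair : ∀ a b → ℕ → ℕ → Vec ℤ (nVert a b) → Set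
  FitsPair a b U V x = Σ[ p ∈ Vec ℤ (suc a) ] Σ[ q ∈ Vec ℤ (suc b) ] Fits U V p × Fits V U q × x ≡ p Vec.++ q

  pairs : ∀ a b → ℕ → ℕ → List (Vec ℤ (nVert a b))
  pairs a b U V = cartesianProductWith Vec._++_ (fitting a U V) (fitting b V U)

  ∈-pairs⁺ : ∀ a b {U V x} → FitsPair a b U V x → x ∈ pairs a b U V
  ∈-pairs⁺ a b (p , q , fp , fq , refl) = ∈-cartesianProductWith⁺ Vec._++_ (∈-fitting⁺ a p fp) (∈-fitting⁺ b q fq)

  ∈-pairs⁻ : ∀ a b {U V x} → x ∈ pairs a b U V → FitsPair a b U V x
  ∈-pairs⁻ a b {U} {V} x∈ with p , q , p∈ , q∈ , e ← ∈-cartesianProductWith⁻ Vec._++_ (fitting a U V) (fitting b V U) x∈ =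
    p , q , ∈-fitting⁻ a p p∈ , ∈-fitting⁻ b q q∈ , e

  pairs-unique : ∀ a b U V → Unique (pairs a b U V)
  pairs-unique a b U V = cartesianProductWith⁺ Vec._++_ (λ {w} {x} → Vec.++-injective w x)
    (fitting-unique a U V) (fitting-unique b V U)

  layer : ∀ a b → ℕ → List (Vec ℤ (nVert a b))
  layer a b n = antiList n (pairs a b)

  lowerLayer : ∀ a b → ℕ → List (Vec ℤ (nVert a b))
  lowerLayer a b n = predList n (pairs a b)

  -- Both fits split x at the same place and hence share the left vector p. Its positive and
  -- negative sums m and k are therefore common, and only the slack can differ.
  FitsPair-slack : ∀ a b {U V U′ V′ x} → FitsPair a b U V x → FitsPair a b U′ V′ x →
    ∃₂ λ m c → ∃₂ λ k c′ → m + c ≡ U × k + c ≡ V × m + c′ ≡ U′ × k + c′ ≡ V′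
  FitsPair-slack a b (p , q , (c , e , f) , _ , refl) (p′ , q′ , (c′ , e′ , f′) , _ , r)
    with refl , _ ← Vec.++-injective p p′ r = posSum p , c , negSum p , c′ , e , f , e′ , f′

  doubled : ∀ m k c → m + c + (k + c) ≡ m + k + 2 * c
  doubled = solve-∀

  layer-unique : ∀ a b n → Unique (layer a b n)
  layer-unique a b n = antiList-unique n (pairs a b) (λ U V _ → pairs-unique a b U V) determined
    where
    determined : ∀ {x} U V U′ V′ → U + V ≡ n → U′ + V′ ≡ n → x ∈ pairs a b U V → x ∈ pairs a b U′ V′ → U ≡ U′
    determined U V U′ V′ s s′ x∈ x∈′
      with m , c , k , c′ , refl , refl , refl , refl ← FitsPair-slack a b (∈-pairs⁻ a b x∈) (∈-pairs⁻ a b x∈′) =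
      -- U + V = m + k + 2c, so the prescribed sum n fixes the slack c and with it U.
      cong (λ s → m + s) (*-cancelˡ-≡ c c′ 2 (+-cancelˡ-≡ (m + k) _ _
        (trans (sym (doubled m k c)) (trans (trans s (sym s′)) (doubled m k c′)))))

  lowerLayer-unique : ∀ a b n → Unique (lowerLayer a b n)
  lowerLayer-unique a b zero    = []
  lowerLayer-unique a b (suc n) = layer-unique a b n

  -- For a given point U + V always has the parity of m + k, so it cannot take two consecutive
  -- values.
  layers-disjoint : ∀ a b {U V U′ V′ x} → FitsPair a b U V x → FitsPair a b U′ V′ x → U + V ≢ suc (U′ + V′)
  layers-disjoint a b fits fits′ e with m , c , k , c′ , refl , refl , refl , refl ← FitsPair-slack a b fits fits′ =
    even≢odd c c′ (+-cancelˡ-≡ (m + k) _ _ (begin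
      m + k + 2 * c               ≡⟨ doubled m k c ⟨
      m + c + (k + c)             ≡⟨ e ⟩
      suc (m + c′ + (k + c′))     ≡⟨ cong suc (doubled m k c′) ⟩
      suc (m + k + 2 * c′)        ≡⟨ +-suc (m + k) (2 * c′) ⟨
      m + k + suc (2 * c′)        ∎))

  latticePoints : ∀ a b → ℕ → List (Vec ℤ (nVert a b))
  latticePoints a b n = layer a b n ++ lowerLayer a b n

  latticePoints-unique : ∀ a b n → Unique (latticePoints a b n)
  latticePoints-unique a b n = ++⁺ (layer-unique a b n) (lowerLayer-unique a b n) λ (x∈ , x∈′) →
    let (U  , V  , s  , x∈p)  = ∈-antiList⁻ n _ x∈
        (U′ , V′ , s′ , x∈p′) = ∈-predList⁻ n _ x∈′
    in layers-disjoint a b (∈-pairs⁻ a b x∈p) (∈-pairs⁻ a b x∈p′) (trans s (sym s′))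

  length-layer : ∀ a b n → length (layer a b n) ≡ pairCount a b n
  length-layer a b n = trans (length-antiList n _) (anti-cong n λ U V _ →
    trans (length-cartesianProductWith Vec._++_ (fitting a U V) (fitting b V U))
      (cong₂ _*_ (length-fitting a U V) (length-fitting b V U)))

  length-lowerLayer : ∀ a b n → length (lowerLayer a b n) ≡ pairCountPred a b n
  length-lowerLayer a b zero    = refl
  length-lowerLayer a b (suc n) = length-layer a b n

  length-latticePoints : ∀ a b n → length (latticePoints a b n) ≡ ehrhartFromH (dim a b) (rhsCoeff a b) n
  length-latticePoints a b n = trans (length-++ (layer a b n))
    (trans (cong₂ _+_ (length-layer a b n) (length-lowerLayer a b n)) (pairCount-ehrhart a b n))

  -- U - V is the coordinate sum of the left part of x, so its parity decides between U + V = n and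
  -- U + V = n - 1.
  Balanced : ∀ a b → ℕ → Vec ℤ (nVert a b) → Set
  Balanced a b n x = ∃₂ λ U V → (U + V ≡ n ⊎ suc (U + V) ≡ n) × FitsPair a b U V x

  ∈-latticePoints : ∀ a b n {x} → x ∈ latticePoints a b n ⇔ Balanced a b n x
  ∈-latticePoints a b n {x} = mk⇔ to from
    where
    to : x ∈ latticePoints a b n → Balanced a b n x
    to x∈ with ∈-++⁻ (layer a b n) x∈
    ... | inj₁ x∈ˡ with U , V , s , x∈p ← ∈-antiList⁻ n _ x∈ˡ = U , V , inj₁ s , ∈-pairs⁻ a b x∈p
    ... | inj₂ x∈ʳ with U , V , s , x∈p ← ∈-predList⁻ n _ x∈ʳ = U , V , inj₂ s , ∈-pairs⁻ a b x∈p
    from : Balanced a b n x → x ∈ latticePoints a b n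
    from (U , V , inj₁ refl , fits) = ∈-++⁺ˡ (∈-antiList⁺ U V (pairs a b) (∈-pairs⁺ a b fits))
    from (U , V , inj₂ refl , fits) = ∈-++⁺ʳ (layer a b (suc (U + V))) (∈-antiList⁺ U V (pairs a b) (∈-pairs⁺ a b fits))

module Dilation where

  open Enumeration
  open import Data.Bool using (Bool; true; false)
  open import Data.Fin using (Fin; zero; suc; splitAt)
  open import Data.Fin.Properties as Fin using () renaming (_≟_ to _≟ᶠ_)
  open import Data.Integer as ℤ using (ℤ; -[1+_])
  open import Data.Integer.Properties as ℤ using ()
  open import Data.Nat as ℕ using (zero; suc)
  open import Data.Nat.Coprimality as Coprime using (1-coprimeTo)
  open import Data.Nat.Properties as ℕ using ()
  import Data.Nat.Tactic.RingSolver as ℕ-Ring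
  open import Data.Product using (∃; ∃₂; Σ-syntax)
  open import Data.Rational
  open import Data.Rational.Properties
  open import Data.Sum using (_⊎_; inj₁; inj₂)
  open import Data.Vec as Vec using (Vec; []; _∷_; lookup)
  import Data.Vec.Properties as Vec
  open import Relation.Nullary using (yes; no; contradiction)
  open import Relation.Nullary.Decidable.Core using (dec⇒maybe)
  open import Tactic.RingSolver using (solve-∀)
  open import Tactic.RingSolver.Core.AlmostCommutativeRing using (AlmostCommutativeRing; fromCommutativeRing)
  open import Algebra.Bundles using (CommutativeMonoid)
  open import Algebra.Properties.CommutativeSemigroup
    (CommutativeMonoid.commutativeSemigroup +-0-commutativeMonoid) using (interchange)
  open ≡-Reasoning

  -- Rational sums and Kronecker deltas

  ℚ-ring : AlmostCommutativeRing _ _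
  ℚ-ring = fromCommutativeRing +-*-commutativeRing (λ p → dec⇒maybe (0ℚ ≟ p))

  sub-interchange : ∀ p q r s → (p - q) + (r - s) ≡ p + r - (q + s)
  sub-interchange = solve-∀ ℚ-ring

  ∑-cong : ∀ n {f g : Fin n → ℚ} → (∀ i → f i ≡ g i) → sumFinℚ n f ≡ sumFinℚ n g
  ∑-cong zero    e = refl
  ∑-cong (suc n) e = cong₂ _+_ (e zero) (∑-cong n (λ i → e (suc i)))

  ∑-zero : ∀ n → sumFinℚ n (λ _ → 0ℚ) ≡ 0ℚ
  ∑-zero zero    = refl
  ∑-zero (suc n) = trans (+-identityˡ _) (∑-zero n)

  ∑-+ : ∀ n (f g : Fin n → ℚ) → sumFinℚ n (λ i → f i + g i) ≡ sumFinℚ n f + sumFinℚ n g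
  ∑-+ zero    f g = refl
  ∑-+ (suc n) f g = trans (cong (f zero + g zero +_) (∑-+ n _ _)) (interchange (f zero) (g zero) _ _)

  ∑-sub : ∀ n (f g : Fin n → ℚ) → sumFinℚ n (λ i → f i - g i) ≡ sumFinℚ n f - sumFinℚ n g
  ∑-sub zero    f g = refl
  ∑-sub (suc n) f g = trans (cong (f zero - g zero +_) (∑-sub n _ _)) (sub-interchange (f zero) (g zero) _ _)

  ∑-*ˡ : ∀ n c (f : Fin n → ℚ) → sumFinℚ n (λ i → c * f i) ≡ c * sumFinℚ n f
  ∑-*ˡ zero    c f = sym (*-zeroʳ c)
  ∑-*ˡ (suc n) c f = trans (cong (c * f zero +_) (∑-*ˡ n c _)) (sym (*-distribˡ-+ c (f zero) _))

  ∑-*ʳ : ∀ n c (f : Fin n → ℚ) → sumFinℚ n (λ i → f i * c) ≡ sumFinℚ n f * c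
  ∑-*ʳ zero    c f = sym (*-zeroˡ c)
  ∑-*ʳ (suc n) c f = trans (cong (f zero * c +_) (∑-*ʳ n c _)) (sym (*-distribʳ-+ c (f zero) _))

  ∑-comm : ∀ m n (f : Fin m → Fin n → ℚ) →
    sumFinℚ m (λ i → sumFinℚ n (f i)) ≡ sumFinℚ n (λ j → sumFinℚ m (λ i → f i j))
  ∑-comm zero    n f = sym (∑-zero n)
  ∑-comm (suc m) n f = trans (cong (sumFinℚ n (f zero) +_) (∑-comm m n _)) (sym (∑-+ n (f zero) _))

  ∑-nonNeg : ∀ n {f : Fin n → ℚ} → (∀ i → 0ℚ ≤ f i) → 0ℚ ≤ sumFinℚ n f
  ∑-nonNeg zero    f≥0 = ≤-refl
  ∑-nonNeg (suc n) f≥0 = +-mono-≤ (f≥0 zero) (∑-nonNeg n (λ i → f≥0 (suc i)))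

  p≤p+q : ∀ p {q} → 0ℚ ≤ q → p ≤ p + q
  p≤p+q p q≥0 = ≤-trans (≤-reflexive (sym (+-identityʳ p))) (+-monoʳ-≤ p q≥0)

  p≤q+p : ∀ p {q} → 0ℚ ≤ q → p ≤ q + p
  p≤q+p p q≥0 = ≤-trans (≤-reflexive (sym (+-identityˡ p))) (+-monoˡ-≤ p q≥0)

  term≤∑ : ∀ n {f : Fin n → ℚ} → (∀ i → 0ℚ ≤ f i) → ∀ i → f i ≤ sumFinℚ n f
  term≤∑ (suc n) f≥0 zero    = p≤p+q _ (∑-nonNeg n (λ i → f≥0 (suc i)))
  term≤∑ (suc n) f≥0 (suc i) = ≤-trans (term≤∑ n (λ i → f≥0 (suc i)) i) (p≤q+p _ (f≥0 zero))

  *-nonNeg : ∀ {p q} → 0ℚ ≤ p → 0ℚ ≤ q → 0ℚ ≤ p * q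
  *-nonNeg {p} {q} p≥0 q≥0 =
    nonNegative⁻¹ (p * q) {{nonNeg*nonNeg⇒nonNeg p {{nonNegative p≥0}} q {{nonNegative q≥0}}}}

  δ-refl : ∀ {m} (u : Fin m) → δ u u ≡ 1ℚ
  δ-refl u with u ≟ᶠ u
  ... | yes _ = refl
  ... | no u≢u = contradiction refl u≢u

  δ-≢ : ∀ {m} {u v : Fin m} → u ≢ v → δ u v ≡ 0ℚ
  δ-≢ {u = u} {v} u≢v with u ≟ᶠ v
  ... | yes u≡v = contradiction u≡v u≢v
  ... | no _ = refl

  δ-injective : ∀ {m n} (f : Fin m → Fin n) → (∀ {i j} → f i ≡ f j → i ≡ j) → ∀ u v → δ (f u) (f v) ≡ δ u v
  δ-injective f f-inj u v with u ≟ᶠ v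
  ... | yes refl = δ-refl (f u)
  ... | no u≢v   = δ-≢ (λ fu≡fv → u≢v (f-inj fu≡fv))

  ∑-δ : ∀ n (f : Fin n → ℚ) k → sumFinℚ n (λ i → f i * δ k i) ≡ f k
  ∑-δ (suc n) f zero    = begin
    f zero * 1ℚ + sumFinℚ n (λ i → f (suc i) * 0ℚ)  ≡⟨ cong₂ _+_ (*-identityʳ (f zero)) (∑-*ʳ n 0ℚ _) ⟩
    f zero + sumFinℚ n (λ i → f (suc i)) * 0ℚ       ≡⟨ cong (f zero +_) (*-zeroʳ (sumFinℚ n (λ i → f (suc i)))) ⟩
    f zero + 0ℚ                                     ≡⟨ +-identityʳ (f zero) ⟩
    f zero                                          ∎
  ∑-δ (suc n) f (suc k) = begin
    f zero * 0ℚ + sumFinℚ n (λ i → f (suc i) * δ (suc k) (suc i))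
      ≡⟨ cong₂ _+_ (*-zeroʳ (f zero)) (∑-cong n (λ i → cong (f (suc i) *_) (δ-injective suc Fin.suc-injective k i))) ⟩
    0ℚ + sumFinℚ n (λ i → f (suc i) * δ k i)
      ≡⟨ trans (+-identityˡ _) (∑-δ n (λ i → f (suc i)) k) ⟩
    f (suc k) ∎

  -- Coordinates of a weighted sum of generators

  module _ (a b : ℕ) where

    leftV≢rightV : ∀ i j → leftV a b i ≢ rightV a b j
    leftV≢rightV i j e with () ← trans (sym (Fin.splitAt-↑ˡ (suc a) i (suc b)))
      (trans (cong (splitAt (suc a)) e) (Fin.splitAt-↑ʳ (suc a) (suc b) j))

    module _ (c : Fin (suc a) → Fin (suc b) → Bool → ℚ) where

      private
        regroup : ∀ p q d → p * (d - 0ℚ) + q * (0ℚ - d) ≡ (p - q) * d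
        regroup = solve-∀ ℚ-ring

      -- The delta of the right endpoint vanishes at a left vertex, and that of the left endpoint
      -- selects row k; the two orientations enter with opposite signs.
      sumGen-leftV : ∀ k → sumGen a b (λ i j s → c i j s * generator a b i j s (leftV a b k)) ≡
        sumFinℚ (suc b) (λ j → c k j true) - sumFinℚ (suc b) (λ j → c k j false)
      sumGen-leftV k = begin
        sumGen a b (λ i j s → c i j s * generator a b i j s (leftV a b k))
          ≡⟨ ∑-cong (suc a) (λ i → ∑-cong (suc b) (simplify i)) ⟩
        sumFinℚ (suc a) (λ i → sumFinℚ (suc b) (λ j → (c i j true - c i j false) * δ k i))
          ≡⟨ ∑-cong (suc a) (λ i → ∑-*ʳ (suc b) (δ k i) (λ j → c i j true - c i j false)) ⟩
        sumFinℚ (suc a) (λ i → sumFinℚ (suc b) (λ j → c i j true - c i j false) * δ k i)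
          ≡⟨ ∑-δ (suc a) (λ i → sumFinℚ (suc b) (λ j → c i j true - c i j false)) k ⟩
        sumFinℚ (suc b) (λ j → c k j true - c k j false)
          ≡⟨ ∑-sub (suc b) (λ j → c k j true) (λ j → c k j false) ⟩
        sumFinℚ (suc b) (λ j → c k j true) - sumFinℚ (suc b) (λ j → c k j false) ∎
        where
        simplify : ∀ i j →
          c i j true  * (δ (leftV a b k) (leftV a b i) - δ (leftV a b k) (rightV a b j)) +
          c i j false * (δ (leftV a b k) (rightV a b j) - δ (leftV a b k) (leftV a b i)) ≡
          (c i j true - c i j false) * δ k i
        simplify i j = trans
          (cong₂ (λ d e → c i j true * (d - e) + c i j false * (e - d))
            (δ-injective (leftV a b) (Fin.↑ˡ-injective (suc b) _ _) k i) (δ-≢ (leftV≢rightV k j)))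
          (regroup (c i j true) (c i j false) (δ k i))

      sumGen-rightV : ∀ k → sumGen a b (λ i j s → c i j s * generator a b i j s (rightV a b k)) ≡
        sumFinℚ (suc a) (λ i → c i k false) - sumFinℚ (suc a) (λ i → c i k true)
      sumGen-rightV k = begin
        sumGen a b (λ i j s → c i j s * generator a b i j s (rightV a b k))
          ≡⟨ ∑-cong (suc a) (λ i → ∑-cong (suc b) (simplify i)) ⟩
        sumFinℚ (suc a) (λ i → sumFinℚ (suc b) (λ j → (c i j false - c i j true) * δ k j))
          ≡⟨ ∑-cong (suc a) (λ i → ∑-δ (suc b) (λ j → c i j false - c i j true) k) ⟩
        sumFinℚ (suc a) (λ i → c i k false - c i k true)
          ≡⟨ ∑-sub (suc a) (λ i → c i k false) (λ i → c i k true) ⟩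
        sumFinℚ (suc a) (λ i → c i k false) - sumFinℚ (suc a) (λ i → c i k true) ∎
        where
        simplify : ∀ i j →
          c i j true  * (δ (rightV a b k) (leftV a b i) - δ (rightV a b k) (rightV a b j)) +
          c i j false * (δ (rightV a b k) (rightV a b j) - δ (rightV a b k) (leftV a b i)) ≡
          (c i j false - c i j true) * δ k j
        simplify i j = trans
          (cong₂ (λ d e → c i j true * (e - d) + c i j false * (d - e))
            (δ-injective (rightV a b) (Fin.↑ʳ-injective (suc a) _ _) k j) (δ-≢ (λ e → leftV≢rightV i k (sym e))))
          (trans (+-comm (c i j true * (0ℚ - δ k j)) _) (regroup (c i j false) (c i j true) (δ k j)))

      sumGen-split : sumGen a b c ≡
        sumFinℚ (suc a) (λ i → sumFinℚ (suc b) (λ j → c i j true)) +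
        sumFinℚ (suc a) (λ i → sumFinℚ (suc b) (λ j → c i j false))
      sumGen-split = trans
        (∑-cong (suc a) (λ i → ∑-+ (suc b) (λ j → c i j true) (λ j → c i j false)))
        (∑-+ (suc a) (λ i → sumFinℚ (suc b) (λ j → c i j true)) (λ i → sumFinℚ (suc b) (λ j → c i j false)))

  -- Integers in ℚ, signed parts and norms

  ℕtoℚ-mkℚ : ∀ n → ℕtoℚ n ≡ mkℚ (ℤ.+ n) 0 (Coprime.sym (1-coprimeTo n))
  -- `ℕtoℚ n` is normalised through a gcd that is stuck on a variable n; the explicit coprime form
  -- lets sums and comparisons reduce to the numerators.
  ℕtoℚ-mkℚ n = normalize-coprime (Coprime.sym (1-coprimeTo n))

  ℕtoℚ-+ : ∀ m n → ℕtoℚ (m ℕ.+ n) ≡ ℕtoℚ m + ℕtoℚ n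
  ℕtoℚ-+ m n = sym (trans (cong₂ _+_ (ℕtoℚ-mkℚ m) (ℕtoℚ-mkℚ n))
    (cong (_/ 1) (cong₂ ℤ._+_ (ℤ.*-identityʳ (ℤ.+ m)) (ℤ.*-identityʳ (ℤ.+ n)))))

  ℕtoℚ-nonNeg : ∀ n → 0ℚ ≤ ℕtoℚ n
  ℕtoℚ-nonNeg n = nonNegative⁻¹ (ℕtoℚ n) {{normalize-nonNeg n 1}}

  ℕtoℚ-cancel-≤ : ∀ m n → ℕtoℚ m ≤ ℕtoℚ n → m ℕ.≤ n
  ℕtoℚ-cancel-≤ m n m≤n with *≤* le ← subst₂ _≤_ (ℕtoℚ-mkℚ m) (ℕtoℚ-mkℚ n) m≤n =
    ℤ.drop‿+≤+ (subst₂ ℤ._≤_ (ℤ.*-identityʳ (ℤ.+ m)) (ℤ.*-identityʳ (ℤ.+ n)) le)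

  ℕtoℚ-injective : ∀ m n → ℕtoℚ m ≡ ℕtoℚ n → m ≡ n
  ℕtoℚ-injective m n e = ℕ.≤-antisym (ℕtoℚ-cancel-≤ m n (≤-reflexive e)) (ℕtoℚ-cancel-≤ n m (≤-reflexive (sym e)))

  ℤtoℚ-pos-neg : ∀ x → ℤtoℚ x ≡ ℕtoℚ (posPart x) - ℕtoℚ (negPart x)
  ℤtoℚ-pos-neg (ℤ.+ n)  = sym (+-identityʳ (ℕtoℚ n))
  ℤtoℚ-pos-neg -[1+ n ] = sym (+-identityˡ (- ℕtoℚ (suc n)))

  parts-balance : ∀ x p q → ℤtoℚ x ≡ p - q → ℕtoℚ (posPart x) + q ≡ ℕtoℚ (negPart x) + p
  parts-balance x p q e = begin
    x⁺ + q                 ≡⟨ expand x⁺ x⁻ q ⟩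
    (x⁺ - x⁻) + (x⁻ + q)   ≡⟨ cong (_+ (x⁻ + q)) (trans (sym (ℤtoℚ-pos-neg x)) e) ⟩
    (p - q) + (x⁻ + q)     ≡⟨ contract x⁻ p q ⟩
    x⁻ + p                 ∎
    where
    x⁺ = ℕtoℚ (posPart x)
    x⁻ = ℕtoℚ (negPart x)
    expand : ∀ p q s → p + s ≡ (p - q) + (q + s)
    expand = solve-∀ ℚ-ring
    contract : ∀ q r s → (r - s) + (q + s) ≡ q + r
    contract = solve-∀ ℚ-ring

  -- The equation Σp = Σα - Σβ without subtraction, a form that can descend to ℕ once the totals are
  -- cancelled.
  posSum-balance : ∀ {m} (p : Vec ℤ m) (α β : Fin m → ℚ) → (∀ i → ℤtoℚ (lookup p i) ≡ α i - β i) →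
    ℕtoℚ (posSum p) + sumFinℚ m β ≡ ℕtoℚ (negSum p) + sumFinℚ m α
  posSum-balance []      α β e = refl
  posSum-balance {suc m} (x ∷ p) α β e = begin
    ℕtoℚ (posPart x ℕ.+ posSum p) + sumFinℚ (suc m) β
      ≡⟨ cong (_+ sumFinℚ (suc m) β) (ℕtoℚ-+ (posPart x) (posSum p)) ⟩
    ℕtoℚ (posPart x) + ℕtoℚ (posSum p) + sumFinℚ (suc m) β
      ≡⟨ interchange (ℕtoℚ (posPart x)) (ℕtoℚ (posSum p)) (β zero) (sumFinℚ m (λ i → β (suc i))) ⟩
    ℕtoℚ (posPart x) + β zero + (ℕtoℚ (posSum p) + sumFinℚ m (λ i → β (suc i)))
      ≡⟨ cong₂ _+_ (parts-balance x (α zero) (β zero) (e zero))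
                   (posSum-balance p (λ i → α (suc i)) (λ i → β (suc i)) (λ i → e (suc i))) ⟩
    ℕtoℚ (negPart x) + α zero + (ℕtoℚ (negSum p) + sumFinℚ m (λ i → α (suc i)))
      ≡⟨ interchange (ℕtoℚ (negPart x)) (α zero) (ℕtoℚ (negSum p)) (sumFinℚ m (λ i → α (suc i))) ⟩
    ℕtoℚ (negPart x) + ℕtoℚ (negSum p) + sumFinℚ (suc m) α
      ≡⟨ cong (_+ sumFinℚ (suc m) α) (ℕtoℚ-+ (negPart x) (negSum p)) ⟨
    ℕtoℚ (negPart x ℕ.+ negSum p) + sumFinℚ (suc m) α ∎

  abs≤ : ∀ x {p q} → ℤtoℚ x ≡ p - q → 0ℚ ≤ p → 0ℚ ≤ q → ℕtoℚ (posPart x ℕ.+ negPart x) ≤ p + q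
  abs≤ x {p} {q} e p≥0 q≥0 = bound x (parts-balance x p q e)
    where
    bound : ∀ x → ℕtoℚ (posPart x) + q ≡ ℕtoℚ (negPart x) + p → ℕtoℚ (posPart x ℕ.+ negPart x) ≤ p + q
    bound (ℤ.+ n)  e = ≤-trans (≤-reflexive (cong ℕtoℚ (ℕ.+-identityʳ n)))
      (≤-trans (p≤p+q (ℕtoℚ n) q≥0) (≤-trans (≤-reflexive (trans e (+-identityˡ p))) (p≤p+q p q≥0)))
    bound -[1+ n ] e = ≤-trans (p≤p+q (ℕtoℚ (suc n)) p≥0)
      (≤-trans (≤-reflexive (trans (sym e) (+-identityˡ q))) (p≤q+p q p≥0))

  norm≤ : ∀ {m} (p : Vec ℤ m) (α β : Fin m → ℚ) → (∀ i → ℤtoℚ (lookup p i) ≡ α i - β i) →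
    (∀ i → 0ℚ ≤ α i) → (∀ i → 0ℚ ≤ β i) → ℕtoℚ (posSum p ℕ.+ negSum p) ≤ sumFinℚ m α + sumFinℚ m β
  norm≤ []              α β e α≥0 β≥0 = ≤-refl
  norm≤ {suc m} (x ∷ p) α β e α≥0 β≥0 = ≤-trans
    (≤-reflexive (trans (cong ℕtoℚ (shuffle (posPart x) (posSum p) (negPart x) (negSum p)))
      (ℕtoℚ-+ (posPart x ℕ.+ negPart x) (posSum p ℕ.+ negSum p))))
    (≤-trans
      (+-mono-≤ (abs≤ x (e zero) (α≥0 zero) (β≥0 zero))
        (norm≤ p (λ i → α (suc i)) (λ i → β (suc i)) (λ i → e (suc i)) (λ i → α≥0 (suc i)) (λ i → β≥0 (suc i))))
      (≤-reflexive (interchange (α zero) (β zero) (sumFinℚ m (λ i → α (suc i))) (sumFinℚ m (λ i → β (suc i))))))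
    where
    shuffle : ∀ a b c d → a ℕ.+ b ℕ.+ (c ℕ.+ d) ≡ a ℕ.+ c ℕ.+ (b ℕ.+ d)
    shuffle = ℕ-Ring.solve-∀

  -- Points of the dilate are balanced

  halve : ∀ n → ∃ λ c → n ≡ c ℕ.+ c ⊎ n ≡ suc (c ℕ.+ c)
  halve zero    = 0 , inj₁ refl
  halve (suc n) with halve n
  ... | c , inj₁ e = c , inj₂ (cong suc e)
  ... | c , inj₂ e = suc c , inj₁ (trans (cong suc e) (cong suc (sym (ℕ.+-suc c c))))

  -- Half of n - (P + N), rounded down, is the slack c for p and fixes U and V. The slack for q must
  -- then be V - Q, which is also U - M because P + Q = N + M; the point to prove is that it is not
  -- negative.
  chooseSlack : ∀ n P N Q M → P ℕ.+ N ℕ.≤ n → Q ℕ.+ M ℕ.≤ n → P ℕ.+ Q ≡ N ℕ.+ M →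
    ∃₂ λ U V → (U ℕ.+ V ≡ n ⊎ suc (U ℕ.+ V) ≡ n) ×
      (∃ λ c → P ℕ.+ c ≡ U × N ℕ.+ c ≡ V) × (∃ λ c → Q ℕ.+ c ≡ V × M ℕ.+ c ≡ U)
  chooseSlack n P N Q M P+N≤n Q+M≤n e with c , split ← halve (n ℕ.∸ (P ℕ.+ N)) =
    U , V , total , (c , refl , refl) , (V ℕ.∸ Q , Q+c′≡V , ℕ.+-cancelˡ-≡ Q _ _ (begin
      Q ℕ.+ (M ℕ.+ (V ℕ.∸ Q))  ≡⟨ swap Q M (V ℕ.∸ Q) ⟩
      M ℕ.+ (Q ℕ.+ (V ℕ.∸ Q))  ≡⟨ cong (M ℕ.+_) Q+c′≡V ⟩
      M ℕ.+ V                  ≡⟨ Q+U≡M+V ⟨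
      Q ℕ.+ U                  ∎))
    where
    U = P ℕ.+ c
    V = N ℕ.+ c
    regroup : ∀ P N c → P ℕ.+ N ℕ.+ (c ℕ.+ c) ≡ P ℕ.+ c ℕ.+ (N ℕ.+ c)
    regroup = ℕ-Ring.solve-∀
    swap : ∀ a b c → a ℕ.+ (b ℕ.+ c) ≡ b ℕ.+ (a ℕ.+ c)
    swap = ℕ-Ring.solve-∀
    swap′ : ∀ a b c → a ℕ.+ (b ℕ.+ c) ≡ b ℕ.+ a ℕ.+ c
    swap′ = ℕ-Ring.solve-∀
    swap″ : ∀ a b c → a ℕ.+ b ℕ.+ c ≡ b ℕ.+ (a ℕ.+ c)
    swap″ = ℕ-Ring.solve-∀
    fill : n ℕ.∸ (P ℕ.+ N) ≡ c ℕ.+ c ⊎ n ℕ.∸ (P ℕ.+ N) ≡ suc (c ℕ.+ c) → U ℕ.+ V ≡ n ⊎ suc (U ℕ.+ V) ≡ n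
    fill (inj₁ s) = inj₁ (trans (sym (regroup P N c)) (trans (cong (P ℕ.+ N ℕ.+_) (sym s)) (ℕ.m+[n∸m]≡n P+N≤n)))
    fill (inj₂ s) = inj₂ (trans (cong suc (sym (regroup P N c))) (trans (sym (ℕ.+-suc (P ℕ.+ N) (c ℕ.+ c)))
                      (trans (cong (P ℕ.+ N ℕ.+_) (sym s)) (ℕ.m+[n∸m]≡n P+N≤n))))
    total : U ℕ.+ V ≡ n ⊎ suc (U ℕ.+ V) ≡ n
    total = fill split
    n≤1+U+V : n ℕ.≤ suc (U ℕ.+ V)
    n≤1+U+V with total
    ... | inj₁ s = ℕ.≤-trans (ℕ.≤-reflexive (sym s)) (ℕ.n≤1+n _)
    ... | inj₂ s = ℕ.≤-reflexive (sym s)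
    Q+U≡M+V : Q ℕ.+ U ≡ M ℕ.+ V
    Q+U≡M+V = trans (swap′ Q P c) (trans (cong (ℕ._+ c) e) (swap″ N M c))
    Q≤V : Q ℕ.≤ V
    -- If V < Q, then Q + U = M + V forces U < M, so that Q + M ≥ U + V + 2. But Q + M ≤ n ≤ U + V +
    -- 1, as rounding loses at most one.
    Q≤V = ℕ.≮⇒≥ λ V<Q →
      let U<M : U ℕ.< M
          U<M = ℕ.+-cancelʳ-< V U M (ℕ.<-≤-trans (subst (U ℕ.+ V ℕ.<_) (ℕ.+-comm U Q) (ℕ.+-monoʳ-< U V<Q)) (ℕ.≤-reflexive Q+U≡M+V))
      in ℕ.<⇒≱ (ℕ.+-mono-≤-< V<Q U<M)
           (ℕ.≤-trans Q+M≤n (ℕ.≤-trans n≤1+U+V (ℕ.≤-reflexive (cong suc (ℕ.+-comm U V)))))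
    Q+c′≡V : Q ℕ.+ (V ℕ.∸ Q) ≡ V
    Q+c′≡V = ℕ.m+[n∸m]≡n Q≤V

  -- Only the row and column sums of the weights matter. Each has total n over the two orientations,
  -- which bounds both norms by n; and every weight occurs in one row and one column with opposite
  -- signs, which makes Σp + Σq vanish.
  dilate⇒balanced : ∀ a b n x → InDilate a b n x → Balanced a b n x
  dilate⇒balanced a b n x (c , c≥0 , total , coords) =
    let U , V , s , fitsP , fitsQ = chooseSlack n (posSum p) (negSum p) (posSum q) (negSum q)
          (ℕtoℚ-cancel-≤ _ _ (≤-trans (norm≤ p α⁺ α⁻ coordsP α⁺≥0 α⁻≥0) (≤-reflexive A+B≡n)))
          (ℕtoℚ-cancel-≤ _ _ (≤-trans (norm≤ q β⁺ β⁻ coordsQ β⁺≥0 β⁻≥0)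
            (≤-reflexive (trans (cong₂ _+_ (sym ∑α⁻≡∑β⁺) (sym ∑α⁺≡∑β⁻)) (trans (+-comm B A) A+B≡n)))))
          (ℕtoℚ-injective _ _ balance)
    in U , V , s , p , q , fitsP , fitsQ , x≡p++q
    where
    p = Vec.take (suc a) x
    q = Vec.drop (suc a) x
    x≡p++q : x ≡ p Vec.++ q
    x≡p++q = sym (Vec.take++drop≡id (suc a) x)
    α⁺ α⁻ : Fin (suc a) → ℚ
    α⁺ i = sumFinℚ (suc b) (λ j → c i j true)
    α⁻ i = sumFinℚ (suc b) (λ j → c i j false)
    β⁺ β⁻ : Fin (suc b) → ℚ
    β⁺ j = sumFinℚ (suc a) (λ i → c i j false)
    β⁻ j = sumFinℚ (suc a) (λ i → c i j true)
    A = sumFinℚ (suc a) α⁺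
    B = sumFinℚ (suc a) α⁻
    α⁺≥0 : ∀ i → 0ℚ ≤ α⁺ i
    α⁺≥0 i = ∑-nonNeg (suc b) (λ j → c≥0 i j true)
    α⁻≥0 : ∀ i → 0ℚ ≤ α⁻ i
    α⁻≥0 i = ∑-nonNeg (suc b) (λ j → c≥0 i j false)
    β⁺≥0 : ∀ j → 0ℚ ≤ β⁺ j
    β⁺≥0 j = ∑-nonNeg (suc a) (λ i → c≥0 i j false)
    β⁻≥0 : ∀ j → 0ℚ ≤ β⁻ j
    β⁻≥0 j = ∑-nonNeg (suc a) (λ i → c≥0 i j true)
    ∑α⁺≡∑β⁻ : A ≡ sumFinℚ (suc b) β⁻
    ∑α⁺≡∑β⁻ = ∑-comm (suc a) (suc b) (λ i j → c i j true)
    ∑α⁻≡∑β⁺ : B ≡ sumFinℚ (suc b) β⁺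
    ∑α⁻≡∑β⁺ = ∑-comm (suc a) (suc b) (λ i j → c i j false)
    A+B≡n : A + B ≡ ℕtoℚ n
    A+B≡n = trans (sym (sumGen-split a b c)) total
    coordsP : ∀ i → ℤtoℚ (lookup p i) ≡ α⁺ i - α⁻ i
    coordsP i = trans
      (cong ℤtoℚ (trans (sym (Vec.lookup-++ˡ p q i)) (cong (λ y → lookup y (leftV a b i)) (sym x≡p++q))))
      (trans (coords (leftV a b i)) (sumGen-leftV a b c i))
    coordsQ : ∀ j → ℤtoℚ (lookup q j) ≡ β⁺ j - β⁻ j
    coordsQ j = trans
      (cong ℤtoℚ (trans (sym (Vec.lookup-++ʳ p q j)) (cong (λ y → lookup y (rightV a b j)) (sym x≡p++q))))
      (trans (coords (rightV a b j)) (sumGen-rightV a b c j))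
    balance : ℕtoℚ (posSum p ℕ.+ posSum q) ≡ ℕtoℚ (negSum p ℕ.+ negSum q)
    balance = +-cancelʳ (B + A) _ _ (begin
      ℕtoℚ (posSum p ℕ.+ posSum q) + (B + A)
        ≡⟨ cong (_+ (B + A)) (ℕtoℚ-+ (posSum p) (posSum q)) ⟩
      ℕtoℚ (posSum p) + ℕtoℚ (posSum q) + (B + A)
        ≡⟨ interchange (ℕtoℚ (posSum p)) (ℕtoℚ (posSum q)) B A ⟩
      ℕtoℚ (posSum p) + B + (ℕtoℚ (posSum q) + A)
        ≡⟨ cong₂ _+_ (posSum-balance p α⁺ α⁻ coordsP)
             (trans (cong (ℕtoℚ (posSum q) +_) ∑α⁺≡∑β⁻) (trans (posSum-balance q β⁺ β⁻ coordsQ)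
               (cong (ℕtoℚ (negSum q) +_) (sym ∑α⁻≡∑β⁺)))) ⟩
      ℕtoℚ (negSum p) + A + (ℕtoℚ (negSum q) + B)
        ≡⟨ regroup (ℕtoℚ (negSum p)) A (ℕtoℚ (negSum q)) B ⟩
      ℕtoℚ (negSum p) + ℕtoℚ (negSum q) + (B + A)
        ≡⟨ cong (_+ (B + A)) (ℕtoℚ-+ (negSum p) (negSum q)) ⟨
      ℕtoℚ (negSum p ℕ.+ negSum q) + (B + A) ∎)
      where
      open import Algebra.Properties.Group +-0-group using () renaming (∙-cancelʳ to +-cancelʳ)
      regroup : ∀ p q r s → p + q + (r + s) ≡ p + r + (s + q)
      regroup = solve-∀ ℚ-ring

  -- Balanced points lie in the dilate

  -- Transportation with margins r and s of common sum X: the weights rᵢ sⱼ / X.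
  transport : ∀ m k (r : Fin m → ℚ) (s : Fin k → ℚ) → (∀ i → 0ℚ ≤ r i) → (∀ j → 0ℚ ≤ s j) →
    sumFinℚ m r ≡ sumFinℚ k s →
    Σ[ w ∈ (Fin m → Fin k → ℚ) ] (∀ i j → 0ℚ ≤ w i j) ×
      (∀ i → sumFinℚ k (w i) ≡ r i) × (∀ j → sumFinℚ m (λ i → w i j) ≡ s j)
  transport m k r s r≥0 s≥0 e with sumFinℚ m r ≟ 0ℚ
  -- A zero total of nonnegative margins makes every margin zero, so the zero matrix stands in for
  -- the undefined quotient.
  ... | yes ∑r≡0 = (λ _ _ → 0ℚ) , (λ _ _ → ≤-refl) ,
    (λ i → trans (∑-zero k) (vanish m r r≥0 ∑r≡0 i)) ,
    (λ j → trans (∑-zero m) (vanish k s s≥0 (trans (sym e) ∑r≡0) j))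
    where
    vanish : ∀ n (f : Fin n → ℚ) → (∀ i → 0ℚ ≤ f i) → sumFinℚ n f ≡ 0ℚ → ∀ i → 0ℚ ≡ f i
    vanish n f f≥0 ∑f≡0 i = ≤-antisym (f≥0 i) (≤-trans (term≤∑ n f≥0 i) (≤-reflexive ∑f≡0))
  ... | no ∑r≢0 = (λ i j → r i * (s j * v)) ,
    (λ i j → *-nonNeg (r≥0 i) (*-nonNeg (s≥0 j) v≥0)) , rows , columns
    where
    X = sumFinℚ m r
    instance
      X>0 : Positive X
      X>0 = nonNeg∧nonZero⇒pos X {{nonNegative (∑-nonNeg m r≥0)}} {{≢-nonZero ∑r≢0}}
      X≢0 : NonZero X
      X≢0 = pos⇒nonZero X
    v = 1/ X
    v≥0 : 0ℚ ≤ v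
    v≥0 = <⇒≤ (positive⁻¹ v {{1/pos⇒pos X}})
    rows : ∀ i → sumFinℚ k (λ j → r i * (s j * v)) ≡ r i
    rows i = begin
      sumFinℚ k (λ j → r i * (s j * v))  ≡⟨ ∑-*ˡ k (r i) (λ j → s j * v) ⟩
      r i * sumFinℚ k (λ j → s j * v)    ≡⟨ cong (r i *_) (∑-*ʳ k v s) ⟩
      r i * (sumFinℚ k s * v)            ≡⟨ cong (λ y → r i * (y * v)) e ⟨
      r i * (X * v)                      ≡⟨ cong (r i *_) (*-inverseʳ X) ⟩
      r i * 1ℚ                           ≡⟨ *-identityʳ (r i) ⟩
      r i                                ∎
    columns : ∀ j → sumFinℚ m (λ i → r i * (s j * v)) ≡ s j
    columns j = begin
      sumFinℚ m (λ i → r i * (s j * v))  ≡⟨ ∑-*ʳ m (s j * v) r ⟩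
      X * (s j * v)                      ≡⟨ regroup X (s j) v ⟩
      s j * (X * v)                      ≡⟨ cong (s j *_) (*-inverseʳ X) ⟩
      s j * 1ℚ                           ≡⟨ *-identityʳ (s j) ⟩
      s j                                ∎
      where
      regroup : ∀ x y z → x * (y * z) ≡ y * (x * z)
      regroup = solve-∀ ℚ-ring

  ∑-lookup : ∀ {m} (f : ℤ → ℕ) (p : Vec ℤ m) → sumFinℚ m (λ i → ℕtoℚ (f (lookup p i))) ≡ ℕtoℚ (partSum f p)
  ∑-lookup f []      = refl
  ∑-lookup f (x ∷ p) = trans (cong (ℕtoℚ (f x) +_) (∑-lookup f p)) (sym (ℕtoℚ-+ (f x) (partSum f p)))

  -- The surplus κ cancels in the difference α - β; it raises both sums to their prescribed value.
  signedParts : ∀ {m} (p : Vec ℤ (suc m)) κ → 0ℚ ≤ κ → ∃₂ λ α β →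
    (∀ i → 0ℚ ≤ α i) × (∀ i → 0ℚ ≤ β i) × (∀ i → ℤtoℚ (lookup p i) ≡ α i - β i) ×
    sumFinℚ (suc m) α ≡ ℕtoℚ (posSum p) + κ × sumFinℚ (suc m) β ≡ ℕtoℚ (negSum p) + κ
  signedParts {m} (x ∷ p) κ κ≥0 =
    part posPart , part negPart , part-nonNeg posPart , part-nonNeg negPart , difference ,
    part-∑ posPart , part-∑ negPart
    where
    part : (ℤ → ℕ) → Fin (suc m) → ℚ
    -- The whole surplus is put on the first coordinate; the length `suc m` guarantees that there is
    -- one.
    part f zero    = ℕtoℚ (f x) + κ
    part f (suc i) = ℕtoℚ (f (lookup p i))
    part-nonNeg : ∀ f i → 0ℚ ≤ part f i
    part-nonNeg f zero    = +-mono-≤ (ℕtoℚ-nonNeg (f x)) κ≥0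
    part-nonNeg f (suc i) = ℕtoℚ-nonNeg (f (lookup p i))
    difference : ∀ i → ℤtoℚ (lookup (x ∷ p) i) ≡ part posPart i - part negPart i
    difference zero    = trans (ℤtoℚ-pos-neg x) (shift (ℕtoℚ (posPart x)) (ℕtoℚ (negPart x)) κ)
      where
      shift : ∀ p q r → p - q ≡ p + r - (q + r)
      shift = solve-∀ ℚ-ring
    difference (suc i) = ℤtoℚ-pos-neg (lookup p i)
    part-∑ : ∀ f → sumFinℚ (suc m) (part f) ≡ ℕtoℚ (partSum f (x ∷ p)) + κ
    part-∑ f = begin
      ℕtoℚ (f x) + κ + sumFinℚ m (λ i → ℕtoℚ (f (lookup p i)))  ≡⟨ cong (ℕtoℚ (f x) + κ +_) (∑-lookup f p) ⟩
      ℕtoℚ (f x) + κ + ℕtoℚ (partSum f p)                       ≡⟨ swap (ℕtoℚ (f x)) κ (ℕtoℚ (partSum f p)) ⟩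
      ℕtoℚ (f x) + ℕtoℚ (partSum f p) + κ                       ≡⟨ cong (_+ κ) (ℕtoℚ-+ (f x) (partSum f p)) ⟨
      ℕtoℚ (partSum f (x ∷ p)) + κ                              ∎
      where
      swap : ∀ p q r → p + q + r ≡ p + r + q
      swap = solve-∀ ℚ-ring

  -- When U + V = n - 1, the missing unit of weight is split into ½ for each orientation, so that it
  -- changes no coordinate of the point.
  remainder : ∀ {n} s → s ≡ n ⊎ suc s ≡ n → ∃ λ ε → 0ℚ ≤ ε × ℕtoℚ s + (ε + ε) ≡ ℕtoℚ n
  remainder s (inj₁ refl) = 0ℚ , ≤-refl , +-identityʳ (ℕtoℚ s)
  remainder s (inj₂ refl) = ½ , nonNegative⁻¹ ½ , trans (sym (ℕtoℚ-+ s 1)) (cong ℕtoℚ (ℕ.+-comm s 1))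

  -- The two orientations are independent transportation problems: weight on `e_left - e_right`
  -- feeds α⁺ and β⁻, weight on its negative feeds α⁻ and β⁺.
  flow⇒dilate : ∀ a b n (p : Vec ℤ (suc a)) (q : Vec ℤ (suc b)) (α⁺ α⁻ : Fin (suc a) → ℚ) (β⁺ β⁻ : Fin (suc b) → ℚ) →
    (∀ i → 0ℚ ≤ α⁺ i) → (∀ i → 0ℚ ≤ α⁻ i) → (∀ j → 0ℚ ≤ β⁺ j) → (∀ j → 0ℚ ≤ β⁻ j) →
    (∀ i → ℤtoℚ (lookup p i) ≡ α⁺ i - α⁻ i) → (∀ j → ℤtoℚ (lookup q j) ≡ β⁺ j - β⁻ j) →
    sumFinℚ (suc a) α⁺ ≡ sumFinℚ (suc b) β⁻ → sumFinℚ (suc a) α⁻ ≡ sumFinℚ (suc b) β⁺ →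
    sumFinℚ (suc a) α⁺ + sumFinℚ (suc a) α⁻ ≡ ℕtoℚ n → InDilate a b n (p Vec.++ q)
  flow⇒dilate a b n p q α⁺ α⁻ β⁺ β⁻ α⁺≥0 α⁻≥0 β⁺≥0 β⁻≥0 coordsP coordsQ ∑α⁺≡∑β⁻ ∑α⁻≡∑β⁺ total
    with w⁺ , w⁺≥0 , rows⁺ , columns⁺ ← transport (suc a) (suc b) α⁺ β⁻ α⁺≥0 β⁻≥0 ∑α⁺≡∑β⁻
    with w⁻ , w⁻≥0 , rows⁻ , columns⁻ ← transport (suc a) (suc b) α⁻ β⁺ α⁻≥0 β⁺≥0 ∑α⁻≡∑β⁺
    = weight , weight≥0 , weight-total , coordinates
    where
    weight : Fin (suc a) → Fin (suc b) → Bool → ℚ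
    weight i j true  = w⁺ i j
    weight i j false = w⁻ i j
    weight≥0 : ∀ i j s → 0ℚ ≤ weight i j s
    weight≥0 i j true  = w⁺≥0 i j
    weight≥0 i j false = w⁻≥0 i j
    weight-total : sumGen a b weight ≡ ℕtoℚ n
    weight-total = begin
      sumGen a b weight
        ≡⟨ sumGen-split a b weight ⟩
      sumFinℚ (suc a) (λ i → sumFinℚ (suc b) (w⁺ i)) + sumFinℚ (suc a) (λ i → sumFinℚ (suc b) (w⁻ i))
        ≡⟨ cong₂ _+_ (∑-cong (suc a) rows⁺) (∑-cong (suc a) rows⁻) ⟩
      sumFinℚ (suc a) α⁺ + sumFinℚ (suc a) α⁻
        ≡⟨ total ⟩
      ℕtoℚ n ∎
    coordinate : Fin (nVert a b) → Set
    coordinate u = ℤtoℚ (lookup (p Vec.++ q) u) ≡ sumGen a b (λ i j s → weight i j s * generator a b i j s u)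
    left : ∀ i → coordinate (leftV a b i)
    left i = begin
      ℤtoℚ (lookup (p Vec.++ q) (leftV a b i))             ≡⟨ cong ℤtoℚ (Vec.lookup-++ˡ p q i) ⟩
      ℤtoℚ (lookup p i)                                    ≡⟨ coordsP i ⟩
      α⁺ i - α⁻ i                                          ≡⟨ cong₂ _-_ (rows⁺ i) (rows⁻ i) ⟨
      sumFinℚ (suc b) (w⁺ i) - sumFinℚ (suc b) (w⁻ i)      ≡⟨ sumGen-leftV a b weight i ⟨
      sumGen a b (λ k j s → weight k j s * generator a b k j s (leftV a b i)) ∎
    right : ∀ j → coordinate (rightV a b j)
    right j = begin
      ℤtoℚ (lookup (p Vec.++ q) (rightV a b j))            ≡⟨ cong ℤtoℚ (Vec.lookup-++ʳ p q j) ⟩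
      ℤtoℚ (lookup q j)                                    ≡⟨ coordsQ j ⟩
      β⁺ j - β⁻ j                                          ≡⟨ cong₂ _-_ (columns⁻ j) (columns⁺ j) ⟨
      sumFinℚ (suc a) (λ i → w⁻ i j) - sumFinℚ (suc a) (λ i → w⁺ i j) ≡⟨ sumGen-rightV a b weight j ⟨
      sumGen a b (λ i k s → weight i k s * generator a b i k s (rightV a b j)) ∎
    coordinates : ∀ u → coordinate u
    coordinates u with splitAt (suc a) u in eq
    ... | inj₁ i = subst coordinate (Fin.splitAt⁻¹-↑ˡ eq) (left i)
    ... | inj₂ j = subst coordinate (Fin.splitAt⁻¹-↑ʳ eq) (right j)

  balanced⇒dilate : ∀ a b n x → Balanced a b n x → InDilate a b n x
  balanced⇒dilate a b n x (U , V , s , p , q , (c , P+c≡U , N+c≡V) , (c′ , Q+c′≡V , M+c′≡U) , refl)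
    with ε , ε≥0 , total ← remainder (U ℕ.+ V) s
    with α⁺ , α⁻ , α⁺≥0 , α⁻≥0 , coordsP , ∑α⁺ , ∑α⁻ ← signedParts p (ℕtoℚ c + ε) (+-mono-≤ (ℕtoℚ-nonNeg c) ε≥0)
    with β⁺ , β⁻ , β⁺≥0 , β⁻≥0 , coordsQ , ∑β⁺ , ∑β⁻ ← signedParts q (ℕtoℚ c′ + ε) (+-mono-≤ (ℕtoℚ-nonNeg c′) ε≥0)
    = flow⇒dilate a b n p q α⁺ α⁻ β⁺ β⁻ α⁺≥0 α⁻≥0 β⁺≥0 β⁻≥0 coordsP coordsQ
        -- The slacks c and c′ of the two halves may differ, but each brings its half up to the same
        -- totals: U + ε in one orientation and V + ε in the other.
        (trans ∑α⁺≡U+ε (sym (absorb (negSum q) c′ ∑β⁻ M+c′≡U)))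
        (trans ∑α⁻≡V+ε (sym (absorb (posSum q) c′ ∑β⁺ Q+c′≡V)))
        (begin
          sumFinℚ (suc a) α⁺ + sumFinℚ (suc a) α⁻  ≡⟨ cong₂ _+_ ∑α⁺≡U+ε ∑α⁻≡V+ε ⟩
          ℕtoℚ U + ε + (ℕtoℚ V + ε)                ≡⟨ interchange (ℕtoℚ U) ε (ℕtoℚ V) ε ⟩
          ℕtoℚ U + ℕtoℚ V + (ε + ε)                ≡⟨ cong (_+ (ε + ε)) (ℕtoℚ-+ U V) ⟨
          ℕtoℚ (U ℕ.+ V) + (ε + ε)                 ≡⟨ total ⟩
          ℕtoℚ n                                   ∎)
    where
    absorb : ∀ P c {W S} → S ≡ ℕtoℚ P + (ℕtoℚ c + ε) → P ℕ.+ c ≡ W → S ≡ ℕtoℚ W + ε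
    absorb P c e refl = trans e (trans (sym (+-assoc (ℕtoℚ P) (ℕtoℚ c) ε)) (cong (_+ ε) (sym (ℕtoℚ-+ P c))))
    ∑α⁺≡U+ε : sumFinℚ (suc a) α⁺ ≡ ℕtoℚ U + ε
    ∑α⁺≡U+ε = absorb (posSum p) c ∑α⁺ P+c≡U
    ∑α⁻≡V+ε : sumFinℚ (suc a) α⁻ ≡ ℕtoℚ V + ε
    ∑α⁻≡V+ε = absorb (negSum p) c ∑α⁻ N+c≡V

open BinomialSums using (γ-positive)
open Enumeration using (latticePoints; latticePoints-unique; length-latticePoints; ∈-latticePoints)
open Dilation using (balanced⇒dilate; dilate⇒balanced)

theorem4p1 : (a b : ℕ) →
    ((n : ℕ) → LatticeCount a b n (ehrhartFromH (dim a b) (rhsCoeff a b) n))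
    × GammaPositive (dim a b) (rhsCoeff a b)
theorem4p1 a b = (λ n → latticePoints a b n , latticePoints-unique a b n , (λ x → mk⇔
    (λ x∈ → balanced⇒dilate a b n x (Equivalence.to (∈-latticePoints a b n) x∈))
    (λ x∈nP → Equivalence.from (∈-latticePoints a b n) (dilate⇒balanced a b n x x∈nP))) ,
  length-latticePoints a b n) , γ-positive a b
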